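{- $\alpha(n,2) = O\!\left(n/\sqrt{\log^* n}\right)$; that is, there is a constant $C>0$ such that $\alpha(n,2) \le C\, n/\sqrt{\log^* n}$ for all sufficiently large $n$.
   Context: A finite set of points in $\mathbb{R}^d$ is in general position if no hyperplane contains more than $d$ of its points. For a finite set $P\subset\mathbb{R}^d$ in which at most $d+1$ points lie on any hyperplane, $\alpha(P)$ denotes the maximum size of a subset of $P$ in general position, and $\alpha(n,d)=\min\{\alpha(P): P\subset\mathbb{R}^d,\ |P|=n,\ \text{at most } d+1 \text{ points of } P \text{ on any hyperplane}\}$. Thus $\alpha(n,2)$ is the minimum, over $n$-point sets in the plane with no four points on a line, of the largest subset with no three collinear points. $\log^*$ denotes the iterated logarithm. -}

module Defs where

open import Level using (0ℓ)
open import Data.Nat as ℕ using (ℕ; zero; suc)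
open import Data.Nat.Logarithm using (⌊log₂_⌋)
open import Data.Fin using (Fin)
open import Data.Fin.Subset using (Subset; _∈_)
open import Data.Product using (Σ; ∃; _×_; _,_)
open import Data.Sum using (_⊎_)
open import Relation.Nullary using (¬_)
open import Relation.Binary.PropositionalEquality using (_≡_; _≢_)
open import Algebra.Structures using (IsCommutativeRing)
open import Function.Definitions using (Injective)

-- The real numbers, axiomatised as a Dedekind-complete ordered field
-- (unique up to isomorphism).  Theorems are stated for every such structure.
record RealField : Set₁ where
  infixl 6 _+_
  infixl 7 _*_
  infix 4 _≤_
  field
    Carrier : Set
    _+_ _*_ : Carrier → Carrier → Carrier
    -_      : Carrier → Carrier
    0# 1#   : Carrier
    isCommutativeRing : IsCommutativeRing _≡_ _+_ _*_ -_ 0# 1#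
    0≢1     : 0# ≢ 1#
    inverse : ∀ x → x ≢ 0# → Σ Carrier λ y → x * y ≡ 1#
    _≤_     : Carrier → Carrier → Set
    ≤-refl  : ∀ x → x ≤ x
    ≤-antisym : ∀ {x y} → x ≤ y → y ≤ x → x ≡ y
    ≤-trans : ∀ {x y z} → x ≤ y → y ≤ z → x ≤ z
    ≤-total : ∀ x y → x ≤ y ⊎ y ≤ x
    +-mono-≤ : ∀ {x y} z → x ≤ y → x + z ≤ y + z
    *-nonneg : ∀ {x y} → 0# ≤ x → 0# ≤ y → 0# ≤ x * y
    sup : (A : Carrier → Set) → (∃ λ a → A a) → (∃ λ b → ∀ a → A a → a ≤ b) →
          Σ Carrier λ s → (∀ a → A a → a ≤ s) × (∀ b → (∀ a → A a → a ≤ b) → s ≤ b)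

module Plane (ℝ : RealField) where
  open RealField ℝ

  Point : Set
  Point = Carrier × Carrier

  record Line : Set where
    constructor line
    field
      a b c  : Carrier
      nonDeg : ¬ (a ≡ 0# × b ≡ 0#)

  _OnLine_ : Point → Line → Set
  (x , y) OnLine line a b c _ = a * x + b * y ≡ c

  module _ {n : ℕ} (P : Fin n → Point) where

    -- at most 3 = d+1 points of P on any line
    AtMostThreeOnALine : Set
    AtMostThreeOnALine = ∀ (i j k l : Fin n) →
      i ≢ j → i ≢ k → i ≢ l → j ≢ k → j ≢ l → k ≢ l →
      ¬ (Σ Line λ L → P i OnLine L × P j OnLine L × P k OnLine L × P l OnLine L)

    GeneralPosition : Subset n → Set
    GeneralPosition S = ∀ (i j k : Fin n) → i ∈ S → j ∈ S → k ∈ S →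
      i ≢ j → i ≢ k → j ≢ k →
      ¬ (Σ Line λ L → P i OnLine L × P j OnLine L × P k OnLine L)

-- iterated logarithm (base 2): log* n = 0 for n ≤ 1, else 1 + log* ⌊log₂ n⌋.
-- The fuel argument is always sufficient when it is ≥ n, since ⌊log₂ n⌋ < n.
logStarFuel : ℕ → ℕ → ℕ
logStarFuel zero    n             = 0
logStarFuel (suc f) zero          = 0
logStarFuel (suc f) (suc zero)    = 0
logStarFuel (suc f) (suc (suc m)) = suc (logStarFuel f ⌊log₂ suc (suc m) ⌋)

log* : ℕ → ℕ
log* n = logStarFuel n n

{-# OPTIONS --safe #-}
module Submission where

-- In the grid [m]^D consider the D classes of axis-parallel lines, and let P be a random sequence of n = m^(D-1)/u of its
-- points, where u, m and D are suitable powers of y = 81^k.  Few terms of P repeat a point or lie on an axis line with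
-- three earlier ones, since D/u³ is small; deleting them leaves distinct points, at most three on every axis line.  On the
-- other hand no subsequence of more than n/k terms of P is free of axis-collinear triples.  Indeed, build such a
-- subsequence point by point; call a point dead when some axis line through it contains two chosen points, and a line
-- touched when it contains one.  Outside a set of density 1/y, choosing an alive point p either kills many
-- points (if many lines through p were touched) or newly touches many lines that are rich in points with few touched
-- lines (otherwise).  This happens at most n/(2k) times; all other choices lie in the exceptional sets and gain a factor
-- 1/y each, which beats the 2^n subsequences.
--
-- Disjoint copies of the resulting configuration, indexed by t, are lifted by the coordinate t and all monomials of degree
-- at most two in t and the grid coordinates except the squares of the latter; then the only collinear triples are the
-- axis-collinear triples inside one copy, and a generic linear projection to the plane creates no new ones.  Since m^D is
-- only doubly exponential in k, one may take k = log log log n, and log* n ≤ 3 + k.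

open import Defs
open import Algebra.Bundles using (CommutativeRing)
import Algebra.Properties.Ring as RingProperties
import Algebra.Properties.Semiring.Mult as SemiringMult
import Algebra.Solver.Ring.NaturalCoefficients.Default as SemiringSolver
open import Data.Bool using (true; false)
open import Data.Empty using (⊥-elim)
open import Data.Fin using (Fin; zero; suc; toℕ; combine; remQuot; inject≤; _↑ˡ_; _↑ʳ_)
open import Data.Fin.Properties
  using (all?; any?; suc-injective; toℕ-injective; inject≤-injective; remQuot-combine; combine-remQuot; combine-injectiveʳ)
  renaming (_≟_ to _≟F_)
open import Data.Fin.Subset using (Subset; ∣_∣; _∈_; ⊥)
open import Data.Fin.Subset.Properties using (∣p∣≤n; ∉⊥; ∣⊥∣≡0)
import Data.Integer as ℤ
open ℤ using (ℤ; 0ℤ)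
import Data.Integer.Properties as ℤ
import Data.Integer.Tactic.RingSolver as ℤ-Solver
open import Data.List using (List; []; _∷_; map; length; allFin; cartesianProductWith)
  renaming (_++_ to _++ₗ_)
open import Data.List.Membership.Propositional using () renaming (_∈_ to _∈ₗ_)
open import Data.List.Membership.Propositional.Properties using (∈-allFin; ∈-map⁺; ∈-cartesianProductWith⁺)
open import Data.List.Properties using (length-tabulate)
import Data.List.Relation.Unary.All as All
open import Data.List.Relation.Unary.AllPairs using ([]; _∷_)
open import Data.List.Relation.Unary.Any as Any using (here; there)
open import Data.List.Relation.Unary.Unique.Propositional using (Unique)
open import Data.List.Relation.Unary.Unique.Propositional.Properties using (allFin⁺; cartesianProductWith⁺)
open import Data.Nat
open import Data.Nat.DivMod using (_/_; _%_; m/n≡1+[m∸n]/n; /-monoˡ-≤; m/n*n≤m; m≡m%n+[m/n]*n; m%n<n)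
open import Data.Nat.Induction using (<-rec)
open import Data.Nat.Logarithm using (⌊log₂_⌋; ⌊log₂⌋-mono-≤; ⌊log₂[2^n]⌋≡n; ⌊log₂⌊n/2⌋⌋≡⌊log₂n⌋∸1)
open import Data.Nat.Properties hiding (suc-injective)
open import Data.Nat.Tactic.RingSolver using (solve-∀)
open import Data.Product using (Σ; ∃; _×_; _,_; proj₁; proj₂)
open import Data.Sum using (_⊎_; inj₁; inj₂; [_,_]′)
open import Data.Unit using (⊤; tt)
open import Data.Vec using (Vec; []; _∷_; _++_; toList; lookup; splitAt; here; there)
open import Data.Vec.Properties using (≡-dec; ∷-injective; length-toList)
open import Function using (_∘_; id)
open import Function.Definitions using (Injective)
open import Relation.Binary.Definitions using (tri<; tri≈; tri>)
open import Relation.Binary.PropositionalEquality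
open import Relation.Nullary using (Dec; yes; no; ¬_; contradiction)
open import Relation.Nullary.Decidable using (_×-dec_; _⊎-dec_; _→-dec_; ¬?; decidable-stable)

-- Indicators and finite sums

private variable
  A B : Set
  P : A → Set

𝟙 : {P : Set} → Dec P → ℕ
𝟙 (yes _) = 1
𝟙 (no _)  = 0

𝟙≤1 : {P : Set} (P? : Dec P) → 𝟙 P? ≤ 1
𝟙≤1 (yes _) = ≤-refl
𝟙≤1 (no _)  = z≤n

𝟙-mono : {P R : Set} (P? : Dec P) (R? : Dec R) → (P → R) → 𝟙 P? ≤ 𝟙 R?
𝟙-mono (no _)  _       _ = z≤n
𝟙-mono (yes p) (yes _) _ = ≤-refl
𝟙-mono (yes p) (no ¬r) f = ⊥-elim (¬r (f p))

𝟙-cong : {P R : Set} (P? : Dec P) (R? : Dec R) → (P → R) → (R → P) → 𝟙 P? ≡ 𝟙 R?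
𝟙-cong P? R? f g = ≤-antisym (𝟙-mono P? R? f) (𝟙-mono R? P? g)

𝟙-true : {P : Set} (P? : Dec P) → P → 𝟙 P? ≡ 1
𝟙-true (yes _) _ = refl
𝟙-true (no ¬p) p = ⊥-elim (¬p p)

𝟙-false : {P : Set} (P? : Dec P) → ¬ P → 𝟙 P? ≡ 0
𝟙-false (yes p) ¬p = ⊥-elim (¬p p)
𝟙-false (no _)  _  = refl

𝟙-× : {P R : Set} (P? : Dec P) (R? : Dec R) → 𝟙 (P? ×-dec R?) ≡ 𝟙 P? * 𝟙 R?
𝟙-× (yes _) (yes _) = refl
𝟙-× (yes _) (no _)  = refl
𝟙-× (no _)  (yes _) = refl
𝟙-× (no _)  (no _)  = refl

𝟙-⊎ : {P R S : Set} (P? : Dec P) (R? : Dec R) (S? : Dec S) →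
      (P → ¬ R → S) → 𝟙 P? ≤ 𝟙 R? + 𝟙 S?
𝟙-⊎ P? (yes _) S? f = ≤-trans (𝟙≤1 P?) (m≤m+n 1 _)
𝟙-⊎ P? (no ¬r) S? f = 𝟙-mono P? S? (λ p → f p ¬r)

𝟙-disjoint : {P R S : Set} (P? : Dec P) (R? : Dec R) (S? : Dec S) →
             (P → S) → (R → S) → (R → ¬ P) → 𝟙 P? + 𝟙 R? ≤ 𝟙 S?
𝟙-disjoint (yes p) (yes r) S? f g h = ⊥-elim (h r p)
𝟙-disjoint (yes p) (no _)  S? f g h = 𝟙-mono (yes p) S? f
𝟙-disjoint (no _)  R?      S? f g h = 𝟙-mono R? S? g

∑ : List A → (A → ℕ) → ℕ
∑ []      f = 0
∑ (x ∷ L) f = f x + ∑ L f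

syntax ∑ L (λ x → e) = ∑[ x ← L ] e

∑-mono : ∀ (L : List A) {f g : A → ℕ} → (∀ x → f x ≤ g x) → ∑ L f ≤ ∑ L g
∑-mono []      h = z≤n
∑-mono (x ∷ L) h = +-mono-≤ (h x) (∑-mono L h)

∑-cong : ∀ (L : List A) {f g : A → ℕ} → (∀ x → f x ≡ g x) → ∑ L f ≡ ∑ L g
∑-cong []      h = refl
∑-cong (x ∷ L) h = cong₂ _+_ (h x) (∑-cong L h)

∑-mono-< : ∀ {L : List A} {f g : A → ℕ} {x} → x ∈ₗ L → (∀ y → f y ≤ g y) → f x < g x → ∑ L f < ∑ L g
∑-mono-< {L = _ ∷ L} (here refl) h lt = +-mono-<-≤ lt (∑-mono L h)
∑-mono-< {L = y ∷ _} (there x∈L) h lt = +-mono-≤-< (h y) (∑-mono-< x∈L h lt)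

∑-+ : ∀ (L : List A) (f g : A → ℕ) → ∑[ x ← L ] (f x + g x) ≡ ∑ L f + ∑ L g
∑-+ []      f g = refl
∑-+ (x ∷ L) f g = trans (cong (f x + g x +_) (∑-+ L f g)) (lemma (f x) (g x) (∑ L f) (∑ L g))
  where lemma : ∀ a b c d → a + b + (c + d) ≡ a + c + (b + d)
        lemma = solve-∀

∑-*ˡ : ∀ (L : List A) c (f : A → ℕ) → ∑[ x ← L ] (c * f x) ≡ c * ∑ L f
∑-*ˡ []      c f = sym (*-zeroʳ c)
∑-*ˡ (x ∷ L) c f = trans (cong (c * f x +_) (∑-*ˡ L c f)) (sym (*-distribˡ-+ c (f x) (∑ L f)))

∑-*ʳ : ∀ (L : List A) c (f : A → ℕ) → ∑[ x ← L ] (f x * c) ≡ ∑ L f * c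
∑-*ʳ L c f = trans (∑-cong L (λ x → *-comm (f x) c)) (trans (∑-*ˡ L c f) (*-comm c _))

∑-const : ∀ (L : List A) c → ∑[ _ ← L ] c ≡ length L * c
∑-const []      c = refl
∑-const (x ∷ L) c = cong (c +_) (∑-const L c)

∑-swap : ∀ (L : List A) (K : List B) (f : A → B → ℕ) →
         ∑[ x ← L ] ∑[ y ← K ] f x y ≡ ∑[ y ← K ] ∑[ x ← L ] f x y
∑-swap []      K f = sym (trans (∑-const K 0) (*-zeroʳ (length K)))
∑-swap (x ∷ L) K f = trans (cong (∑ K (f x) +_) (∑-swap L K f)) (sym (∑-+ K (f x) (λ y → ∑ L (λ x → f x y))))

∑-++ : ∀ (L K : List A) (f : A → ℕ) → ∑ (L ++ₗ K) f ≡ ∑ L f + ∑ K f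
∑-++ []      K f = refl
∑-++ (x ∷ L) K f = trans (cong (f x +_) (∑-++ L K f)) (sym (+-assoc (f x) _ _))

∑-map : ∀ (g : A → B) (L : List A) (f : B → ℕ) → ∑ (map g L) f ≡ ∑ L (f ∘ g)
∑-map g []      f = refl
∑-map g (x ∷ L) f = cong (f (g x) +_) (∑-map g L f)

∑-cartesianProductWith : ∀ {C : Set} (g : A → B → C) (L : List A) (K : List B) (f : C → ℕ) →
  ∑ (cartesianProductWith g L K) f ≡ ∑[ x ← L ] ∑[ y ← K ] f (g x y)
∑-cartesianProductWith g []      K f = refl
∑-cartesianProductWith g (x ∷ L) K f =
  trans (∑-++ (map (g x) K) _ f) (cong₂ _+_ (∑-map (g x) K f) (∑-cartesianProductWith g L K f))

term≤∑ : ∀ {L : List A} {x} (f : A → ℕ) → x ∈ₗ L → f x ≤ ∑ L f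
term≤∑ f (here refl) = m≤m+n _ _
term≤∑ f (there x∈L) = m≤n⇒m≤o+n _ (term≤∑ f x∈L)

∑-allFin-const : ∀ n c → ∑[ _ ← allFin n ] c ≡ n * c
∑-allFin-const n c = trans (∑-const (allFin n) c) (cong (_* c) (length-tabulate {n = n} id))

∑-𝟙-none : ∀ (L : List A) (P? : ∀ x → Dec (P x)) → (∀ {x} → x ∈ₗ L → ¬ P x) → ∑ L (𝟙 ∘ P?) ≡ 0
∑-𝟙-none []      P? none = refl
∑-𝟙-none (x ∷ L) P? none = cong₂ _+_ (𝟙-false (P? x) (none (here refl))) (∑-𝟙-none L P? (none ∘ there))

∑-𝟙-unique : ∀ {L : List A} (P? : ∀ x → Dec (P x)) → Unique L → (∀ {x y} → P x → P y → x ≡ y) →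
             ∑ L (𝟙 ∘ P?) ≤ 1
∑-𝟙-unique P? []        one = z≤n
∑-𝟙-unique {L = x ∷ L} P? (x∉ ∷ uniq) one with P? x
... | no _  = ∑-𝟙-unique P? uniq one
... | yes p = ≤-reflexive (cong suc (∑-𝟙-none L P? (λ y∈L py → All.lookup x∉ y∈L (one p py))))

∑-average : ∀ (L : List A) (f : A → ℕ) c → ∑ L f < length L * c → ∃ λ x → f x < c
∑-average (x ∷ L) f c lt with f x <? c
... | yes fx<c = x , fx<c
... | no fx≮c = ∑-average L f c
        (+-cancelˡ-< c _ _ (≤-<-trans (+-monoˡ-≤ (∑ L f) (≮⇒≥ fx≮c)) lt))

-- Touching and killing points in a system of lines

-- An abstraction of the axis lines of `[m]^D`: `p ~[ i ] q` places `p` and `q` on a common line of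
-- direction `i`. The counting arguments up to the grid use only these axioms.
record LineSystem (D m : ℕ) : Set₁ where
  field
    Q       : Set
    _≟Q_    : (p q : Q) → Dec (p ≡ q)
    pts     : List Q
    unique  : Unique pts
    _~[_]_  : Q → Fin D → Q → Set
    sim?    : ∀ p i q → Dec (p ~[ i ] q)
    ~-sym   : ∀ {p i q} → p ~[ i ] q → q ~[ i ] p
    ~-trans : ∀ {p i q s} → p ~[ i ] q → q ~[ i ] s → p ~[ i ] s
    ~-meet  : ∀ {p q i j} → p ≢ q → p ~[ i ] q → p ~[ j ] q → i ≡ j
    line-size : ∀ i q → ∑[ p ← pts ] 𝟙 (sim? p i q) ≡ m

module Lines {D m : ℕ} (LS : LineSystem D m) where
  open LineSystem LS public

  M : ℕ
  M = length pts

  dirs : List (Fin D)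
  dirs = allFin D

  module _ {Y : Q → Set} (Y? : ∀ q → Dec (Y q)) where

    onLine : Fin D → Q → ℕ
    onLine i p = ∑[ q ← pts ] 𝟙 (Y? q ×-dec sim? q i p)

    onLine-cong : ∀ {i p s} → p ~[ i ] s → onLine i p ≡ onLine i s
    onLine-cong {i} {p} {s} p~s = ∑-cong pts λ q → 𝟙-cong (Y? q ×-dec sim? q i p) (Y? q ×-dec sim? q i s)
      (λ (y , q~p) → y , ~-trans q~p p~s) (λ (y , q~s) → y , ~-trans q~s (~-sym p~s))

    -- Since `onLine` is constant along a line, either the whole line has fewer than `w` points of
    -- `Y`, or none of its points is counted.
    poor-line : ∀ i s w → ∑[ p ← pts ] 𝟙 ((Y? p ×-dec sim? p i s) ×-dec (onLine i p <? w)) ≤ w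
    poor-line i s w with onLine i s <? w
    ... | yes lt = ≤-trans (∑-mono pts λ p → 𝟙-mono ((Y? p ×-dec sim? p i s) ×-dec (onLine i p <? w)) _ proj₁) (<⇒≤ lt)
    ... | no ≮w  = ≤-trans (≤-reflexive (∑-𝟙-none pts (λ p → (Y? p ×-dec sim? p i s) ×-dec (onLine i p <? w))
                     λ { _ ((_ , p~s) , lt) → ≮w (subst (_< w) (onLine-cong p~s) lt) })) z≤n

    -- Double counting of pairs on a common `i`-line: each counted point lies in `m` pairs, while by
    -- `poor-line` each `s` lies in at most `w`.
    poor-points : ∀ i w → m * ∑[ p ← pts ] 𝟙 (Y? p ×-dec (onLine i p <? w)) ≤ M * w
    poor-points i w = begin
      m * ∑[ p ← pts ] 𝟙 (Y? p ×-dec (onLine i p <? w))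
        ≡⟨ ∑-*ˡ pts m _ ⟨
      ∑[ p ← pts ] (m * 𝟙 (Y? p ×-dec (onLine i p <? w)))
        ≡⟨ ∑-cong pts (λ p → trans (cong (_* 𝟙 (Y? p ×-dec (onLine i p <? w))) (sym (line-size i p))) (sym (∑-*ʳ pts _ _))) ⟩
      ∑[ p ← pts ] ∑[ s ← pts ] (𝟙 (sim? s i p) * 𝟙 (Y? p ×-dec (onLine i p <? w)))
        ≡⟨ ∑-swap pts pts _ ⟩
      ∑[ s ← pts ] ∑[ p ← pts ] (𝟙 (sim? s i p) * 𝟙 (Y? p ×-dec (onLine i p <? w)))
        ≤⟨ ∑-mono pts (λ s → ≤-trans (∑-mono pts λ p → ≤-trans
             (≤-reflexive (sym (𝟙-× (sim? s i p) (Y? p ×-dec (onLine i p <? w)))))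
             (𝟙-mono (sim? s i p ×-dec (Y? p ×-dec (onLine i p <? w))) ((Y? p ×-dec sim? p i s) ×-dec (onLine i p <? w))
               λ (s~p , y , lt) → (y , ~-sym s~p) , lt)) (poor-line i s w)) ⟩
      ∑[ s ← pts ] w
        ≡⟨ ∑-const pts w ⟩
      M * w ∎
      where open ≤-Reasoning

    module _ {I : Fin D → Set} (I? : ∀ i → Dec (I i)) (p : Q) where

      Fan? : ∀ q → Dec (Y q × ∃ λ i → I i × q ~[ i ] p)
      Fan? q = Y? q ×-dec any? (λ i → I? i ×-dec sim? q i p)

      -- Distinct lines through p meet only in p.
      fan-size : ∀ {w r} → (∀ i → I i → w ≤ onLine i p) → r ≤ ∑ dirs (𝟙 ∘ I?) →
                 r * (w ∸ 1) ≤ ∑ pts (𝟙 ∘ Fan?)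
      fan-size {w} {r} rich r≤c = begin
        r * (w ∸ 1)     ≤⟨ *-monoˡ-≤ (w ∸ 1) r≤c ⟩
        c * (w ∸ 1)     ≡⟨ *-distribˡ-∸ c w 1 ⟩
        c * w ∸ c * 1   ≡⟨ cong (c * w ∸_) (*-identityʳ c) ⟩
        c * w ∸ c       ≤⟨ m≤n+o⇒m∸n≤o (c * w) c total ⟩
        ∑ pts (𝟙 ∘ Fan?) ∎
        where
        open ≤-Reasoning
        c = ∑ dirs (𝟙 ∘ I?)
        incidence? : ∀ q i → Dec (I i × Y q × q ~[ i ] p)
        incidence? q i = I? i ×-dec (Y? q ×-dec sim? q i p)
        per-line : ∀ i → 𝟙 (I? i) * w ≤ ∑[ q ← pts ] 𝟙 (incidence? q i)
        per-line i = ≤-trans (lemma (I? i))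
          (≤-reflexive (trans (sym (∑-*ˡ pts (𝟙 (I? i)) _)) (∑-cong pts λ q → sym (𝟙-× (I? i) _))))
          where
          lemma : (I?i : Dec (I i)) → 𝟙 I?i * w ≤ 𝟙 I?i * onLine i p
          lemma (yes x) = *-monoʳ-≤ 1 (rich i x)
          lemma (no _)  = z≤n
        per-point : ∀ q → ∑[ i ← dirs ] 𝟙 (incidence? q i) ≤ 𝟙 (q ≟Q p) * c + 𝟙 (Fan? q)
        per-point q with q ≟Q p
        ... | yes _ = ≤-trans (∑-mono dirs λ i → 𝟙-mono (incidence? q i) (I? i) proj₁)
                        (≤-trans (≤-reflexive (sym (*-identityˡ c))) (m≤m+n _ _))
        ... | no q≢p with Fan? q
        ...   | yes _ = ∑-𝟙-unique (incidence? q) (allFin⁺ D) λ (_ , _ , a) (_ , _ , b) → ~-meet q≢p a b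
        ...   | no ¬f = ≤-reflexive (∑-𝟙-none dirs (incidence? q) λ { _ (x , y , a) → ¬f (y , _ , x , a) })
        total : c * w ≤ c + ∑ pts (𝟙 ∘ Fan?)
        total = begin
          c * w                                              ≡⟨ ∑-*ʳ dirs w (𝟙 ∘ I?) ⟨
          ∑[ i ← dirs ] (𝟙 (I? i) * w)                       ≤⟨ ∑-mono dirs per-line ⟩
          ∑[ i ← dirs ] ∑[ q ← pts ] 𝟙 (incidence? q i)      ≡⟨ ∑-swap dirs pts _ ⟩
          ∑[ q ← pts ] ∑[ i ← dirs ] 𝟙 (incidence? q i)      ≤⟨ ∑-mono pts per-point ⟩
          ∑[ q ← pts ] (𝟙 (q ≟Q p) * c + 𝟙 (Fan? q))         ≡⟨ ∑-+ pts _ _ ⟩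
          ∑[ q ← pts ] (𝟙 (q ≟Q p) * c) + ∑ pts (𝟙 ∘ Fan?)   ≡⟨ cong (_+ ∑ pts (𝟙 ∘ Fan?)) (∑-*ʳ pts c _) ⟩
          ∑[ q ← pts ] 𝟙 (q ≟Q p) * c + ∑ pts (𝟙 ∘ Fan?)
            ≤⟨ +-monoˡ-≤ _ (*-monoˡ-≤ c (∑-𝟙-unique (_≟Q p) unique λ a b → trans a (sym b))) ⟩
          1 * c + ∑ pts (𝟙 ∘ Fan?)                           ≡⟨ cong (_+ ∑ pts (𝟙 ∘ Fan?)) (*-identityˡ c) ⟩
          c + ∑ pts (𝟙 ∘ Fan?) ∎

  hits : List Q → Fin D → Q → ℕ
  hits σ i q = ∑[ p ← σ ] 𝟙 (sim? p i q)

  hits-cong : ∀ σ {i p q} → p ~[ i ] q → hits σ i p ≡ hits σ i q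
  hits-cong σ p~q = ∑-cong σ λ s → 𝟙-cong (sim? s _ _) (sim? s _ _) (λ a → ~-trans a p~q) (λ a → ~-trans a (~-sym p~q))

  hits≥1⇒∃ : ∀ σ {i q} → 1 ≤ hits σ i q → ∃ λ p → p ∈ₗ σ × p ~[ i ] q
  hits≥1⇒∃ (p ∷ σ) {i} {q} h with sim? p i q
  ... | yes p~q = p , here refl , p~q
  ... | no _ with hits≥1⇒∃ σ h
  ...   | s , s∈σ , s~q = s , there s∈σ , s~q

  -- Choosing an alive point puts no third chosen point on any line through it.
  Alive : List Q → Q → Set
  Alive σ q = ∀ i → hits σ i q ≤ 1

  alive? : ∀ σ q → Dec (Alive σ q)
  alive? σ q = all? (λ i → hits σ i q ≤? 1)

  touched : List Q → Q → ℕ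
  touched σ q = ∑[ i ← dirs ] 𝟙 (1 ≤? hits σ i q)

  hits-∷ : ∀ p σ i q → hits σ i q ≤ hits (p ∷ σ) i q
  hits-∷ p σ i q = m≤n+m _ _

  touched-∷ : ∀ p σ q → touched σ q ≤ touched (p ∷ σ) q
  touched-∷ p σ q = ∑-mono dirs λ i →
    𝟙-mono (1 ≤? hits σ i q) (1 ≤? hits (p ∷ σ) i q) (λ le → ≤-trans le (hits-∷ p σ i q))

  alive-∷ : ∀ p σ {q} → Alive (p ∷ σ) q → Alive σ q
  alive-∷ p σ {q} al i = ≤-trans (hits-∷ p σ i q) (al i)

  hits-∷-sim : ∀ σ {p i q} → q ~[ i ] p → hits (p ∷ σ) i q ≡ suc (hits σ i q)
  hits-∷-sim σ {p} {i} {q} q~p = cong (_+ hits σ i q) (𝟙-true (sim? p i q) (~-sym q~p))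

  module Potential (d r w₁ w₂ : ℕ) (D≡d+d : D ≡ d + d) where

    Fresh? : ∀ σ q → Dec (touched σ q < r + r)
    Fresh? σ q = touched σ q <? (r + r)

    -- Two quantities that never increase while points are chosen. The truncated difference limits
    -- what a single point can ever contribute to the loss of `slack` to `r + r`.
    aliveCount slack : List Q → ℕ
    aliveCount σ = ∑ pts (𝟙 ∘ alive? σ)
    slack σ      = ∑[ q ← pts ] ((r + r) ∸ touched σ q)

    aliveCount-∷ : ∀ p σ → aliveCount (p ∷ σ) ≤ aliveCount σ
    aliveCount-∷ p σ = ∑-mono pts λ q → 𝟙-mono (alive? (p ∷ σ) q) (alive? σ q) (alive-∷ p σ)

    slack-∷ : ∀ p σ → slack (p ∷ σ) ≤ slack σ
    slack-∷ p σ = ∑-mono pts λ q → ∸-monoʳ-≤ (r + r) (touched-∷ p σ q)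

    -- Choosing `p` gives a second hit to all alive points of a killer line, and a first hit to all
    -- fresh points of a spreader line.
    Killer? : ∀ σ p i → Dec (1 ≤ hits σ i p × w₁ ≤ onLine (alive? σ) i p)
    Killer? σ p i = (1 ≤? hits σ i p) ×-dec (w₁ ≤? onLine (alive? σ) i p)

    Spreader? : ∀ σ p i → Dec (hits σ i p < 1 × w₂ ≤ onLine (Fresh? σ) i p)
    Spreader? σ p i = (hits σ i p <? 1) ×-dec (w₂ ≤? onLine (Fresh? σ) i p)

    -- The guaranteed losses of `aliveCount` and `slack`; the `∸ 1` discounts `p` itself, which lies
    -- on all of its lines.
    κ₁ κ₂ : ℕ
    κ₁ = r * (w₁ ∸ 1)
    κ₂ = (d ∸ (r + r)) * (w₂ ∸ 1)

    -- Every fan point already has a hit on its line to `p`, and `p` is the second one. So the fan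
    -- consists of alive points disjoint from those that stay alive.
    kill : ∀ σ p → r ≤ ∑ dirs (𝟙 ∘ Killer? σ p) → aliveCount (p ∷ σ) + κ₁ ≤ aliveCount σ
    kill σ p many = begin
      aliveCount (p ∷ σ) + κ₁
        ≤⟨ +-monoʳ-≤ _ (fan-size (alive? σ) (Killer? σ p) p (λ i → proj₂) many) ⟩
      aliveCount (p ∷ σ) + ∑ pts (𝟙 ∘ Fan? (alive? σ) (Killer? σ p) p)
        ≡⟨ ∑-+ pts _ _ ⟨
      ∑[ q ← pts ] (𝟙 (alive? (p ∷ σ) q) + 𝟙 (Fan? (alive? σ) (Killer? σ p) p q))
        ≤⟨ ∑-mono pts (λ q → 𝟙-disjoint (alive? (p ∷ σ) q) (Fan? (alive? σ) (Killer? σ p) p q) (alive? σ q) (alive-∷ p σ) proj₁ dies) ⟩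
      aliveCount σ ∎
      where
      open ≤-Reasoning
      dies : ∀ {q} → Alive σ q × (∃ λ i → (1 ≤ hits σ i p × w₁ ≤ onLine (alive? σ) i p) × q ~[ i ] p) → ¬ Alive (p ∷ σ) q
      dies (_ , i , (hit , _) , q~p) al = <⇒≱ (s≤s (≤-trans hit (≤-reflexive (sym (hits-cong σ q~p)))))
        (≤-trans (≤-reflexive (sym (hits-∷-sim σ q~p))) (al i))

    -- Every fan point gains a touched direction, and being fresh it still has positive slack to
    -- lose.
    spread : ∀ σ p → d ∸ (r + r) ≤ ∑ dirs (𝟙 ∘ Spreader? σ p) → slack (p ∷ σ) + κ₂ ≤ slack σ
    spread σ p many = begin
      slack (p ∷ σ) + κ₂
        ≤⟨ +-monoʳ-≤ _ (fan-size (Fresh? σ) (Spreader? σ p) p (λ i → proj₂) many) ⟩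
      slack (p ∷ σ) + ∑ pts (𝟙 ∘ F?)
        ≡⟨ ∑-+ pts _ _ ⟨
      ∑[ q ← pts ] ((r + r) ∸ touched (p ∷ σ) q + 𝟙 (F? q))
        ≤⟨ ∑-mono pts drop ⟩
      slack σ ∎
      where
      open ≤-Reasoning
      F? = Fan? (Fresh? σ) (Spreader? σ p) p
      drop : ∀ q → (r + r) ∸ touched (p ∷ σ) q + 𝟙 (F? q) ≤ (r + r) ∸ touched σ q
      drop q with F? q
      ... | no _ = ≤-trans (≤-reflexive (+-identityʳ _)) (∸-monoʳ-≤ (r + r) (touched-∷ p σ q))
      ... | yes (fresh , i , (unhit , _) , q~p) = begin
        (r + r) ∸ touched (p ∷ σ) q + 1    ≡⟨ +-comm _ 1 ⟩
        suc ((r + r) ∸ touched (p ∷ σ) q)  ≤⟨ s≤s (∸-monoʳ-≤ (r + r) increase) ⟩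
        suc ((r + r) ∸ suc (touched σ q))  ≡⟨ +-∸-assoc 1 fresh ⟨
        (r + r) ∸ touched σ q ∎
        where
        increase : touched σ q < touched (p ∷ σ) q
        increase = ∑-mono-< (∈-allFin i)
          (λ j → 𝟙-mono (1 ≤? hits σ j q) (1 ≤? hits (p ∷ σ) j q) (λ le → ≤-trans le (hits-∷ p σ j q)))
          (≤-reflexive (trans (cong suc (𝟙-false (1 ≤? hits σ i q) (<⇒≱ (subst (_< 1) (sym (hits-cong σ q~p)) unhit))))
            (sym (𝟙-true (1 ≤? hits (p ∷ σ) i q) (subst (1 ≤_) (sym (hits-∷-sim σ q~p)) (s≤s z≤n))))))

    -- The stuck points form the two exceptional sets: those with many touched directions but few
    -- killers, and those with few touched directions but few rich lines.
    Stuck₁? : ∀ σ p → Dec ((Alive σ p × r + r ≤ touched σ p) × ∑ dirs (𝟙 ∘ Killer? σ p) < r)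
    Stuck₁? σ p = (alive? σ p ×-dec (r + r ≤? touched σ p)) ×-dec (∑ dirs (𝟙 ∘ Killer? σ p) <? r)

    Rich₂? : ∀ σ p i → Dec (w₂ ≤ onLine (Fresh? σ) i p)
    Rich₂? σ p i = w₂ ≤? onLine (Fresh? σ) i p

    Stuck₂? : ∀ σ p → Dec (touched σ p < r + r × ∑ dirs (𝟙 ∘ Rich₂? σ p) < d)
    Stuck₂? σ p = Fresh? σ p ×-dec (∑ dirs (𝟙 ∘ Rich₂? σ p) <? d)

    -- At a stuck point at least `r` touched directions are not killers, so their lines have fewer
    -- than `w₁` alive points. Touched lines pass through a chosen point, so there are at most `D`
    -- of them for each term of `σ`.
    Stuck₁-few : ∀ σ → ∑ pts (𝟙 ∘ Stuck₁? σ) * r ≤ length σ * (D * w₁)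
    Stuck₁-few σ = begin
      ∑ pts (𝟙 ∘ Stuck₁? σ) * r
        ≡⟨ ∑-*ʳ pts r _ ⟨
      ∑[ p ← pts ] (𝟙 (Stuck₁? σ p) * r)
        ≤⟨ ∑-mono pts (λ p → per-point p (Stuck₁? σ p)) ⟩
      ∑[ p ← pts ] ∑[ i ← dirs ] ∑[ s ← σ ] 𝟙 (poor? s i p)
        ≡⟨ ∑-swap pts dirs _ ⟩
      ∑[ i ← dirs ] ∑[ p ← pts ] ∑[ s ← σ ] 𝟙 (poor? s i p)
        ≡⟨ ∑-cong dirs (λ i → ∑-swap pts σ _) ⟩
      ∑[ i ← dirs ] ∑[ s ← σ ] ∑[ p ← pts ] 𝟙 (poor? s i p)
        ≤⟨ ∑-mono dirs (λ i → ∑-mono σ λ s → poor-line (alive? σ) i s w₁) ⟩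
      ∑[ i ← dirs ] ∑[ s ← σ ] w₁
        ≡⟨ trans (∑-allFin-const D _) (cong (D *_) (∑-const σ w₁)) ⟩
      D * (length σ * w₁)
        ≡⟨ lemma D (length σ) w₁ ⟩
      length σ * (D * w₁) ∎
      where
      open ≤-Reasoning
      lemma : ∀ a b c → a * (b * c) ≡ b * (a * c)
      lemma = solve-∀
      poor? : ∀ s i p → Dec ((Alive σ p × p ~[ i ] s) × onLine (alive? σ) i p < w₁)
      poor? s i p = (alive? σ p ×-dec sim? p i s) ×-dec (onLine (alive? σ) i p <? w₁)
      poorHit? : ∀ p i → Dec (1 ≤ hits σ i p × onLine (alive? σ) i p < w₁)
      poorHit? p i = (1 ≤? hits σ i p) ×-dec (onLine (alive? σ) i p <? w₁)
      witness : ∀ p → Alive σ p → ∀ i → 𝟙 (poorHit? p i) ≤ ∑[ s ← σ ] 𝟙 (poor? s i p)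
      witness p al i with poorHit? p i
      ... | no _ = z≤n
      ... | yes (hit , lt) with hits≥1⇒∃ σ hit
      ...   | s , s∈σ , s~p = ≤-trans (≤-reflexive (sym (𝟙-true (poor? s i p) ((al , ~-sym s~p) , lt))))
                                (term≤∑ (λ s → 𝟙 (poor? s i p)) s∈σ)
      per-point : ∀ p (S? : Dec _) → 𝟙 {P = (Alive σ p × r + r ≤ touched σ p) × ∑ dirs (𝟙 ∘ Killer? σ p) < r} S? * r
                  ≤ ∑[ i ← dirs ] ∑[ s ← σ ] 𝟙 (poor? s i p)
      per-point p (no _) = z≤n
      per-point p (yes ((al , many) , few)) = begin
        1 * r ≡⟨ *-identityˡ r ⟩
        r ≤⟨ +-cancelˡ-≤ r _ _ (begin
          r + r                                    ≤⟨ many ⟩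
          touched σ p
            ≤⟨ ∑-mono dirs (λ i → 𝟙-⊎ (1 ≤? hits σ i p) (Killer? σ p i) (poorHit? p i)
                 (λ hit ¬k → hit , ≰⇒> (λ w≤ → ¬k (hit , w≤)))) ⟩
          ∑[ i ← dirs ] (𝟙 (Killer? σ p i) + 𝟙 (poorHit? p i)) ≡⟨ ∑-+ dirs _ _ ⟩
          ∑ dirs (𝟙 ∘ Killer? σ p) + ∑ dirs (𝟙 ∘ poorHit? p)   ≤⟨ +-monoˡ-≤ _ (<⇒≤ few) ⟩
          r + ∑ dirs (𝟙 ∘ poorHit? p)              ∎) ⟩
        ∑ dirs (𝟙 ∘ poorHit? p) ≤⟨ ∑-mono dirs (witness p al) ⟩
        ∑[ i ← dirs ] ∑[ s ← σ ] 𝟙 (poor? s i p) ∎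

    -- Of the `d + d` directions at a stuck point at least `d` are poor in fresh points, and
    -- `poor-points` bounds the points on poor lines of each direction.
    Stuck₂-few : ∀ σ → m * (∑ pts (𝟙 ∘ Stuck₂? σ) * d) ≤ D * (M * w₂)
    Stuck₂-few σ = begin
      m * (∑ pts (𝟙 ∘ Stuck₂? σ) * d)
        ≡⟨ cong (m *_) (∑-*ʳ pts d _) ⟨
      m * ∑[ p ← pts ] (𝟙 (Stuck₂? σ p) * d)
        ≤⟨ *-monoʳ-≤ m (∑-mono pts λ p → per-point p (Stuck₂? σ p)) ⟩
      m * ∑[ p ← pts ] ∑[ i ← dirs ] 𝟙 (poor? p i)
        ≡⟨ cong (m *_) (∑-swap pts dirs _) ⟩
      m * ∑[ i ← dirs ] ∑[ p ← pts ] 𝟙 (poor? p i)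
        ≡⟨ ∑-*ˡ dirs m _ ⟨
      ∑[ i ← dirs ] (m * ∑[ p ← pts ] 𝟙 (poor? p i))
        ≤⟨ ∑-mono dirs (λ i → poor-points (Fresh? σ) i w₂) ⟩
      ∑[ i ← dirs ] (M * w₂)
        ≡⟨ ∑-allFin-const D _ ⟩
      D * (M * w₂) ∎
      where
      open ≤-Reasoning
      poor? : ∀ p i → Dec (touched σ p < r + r × onLine (Fresh? σ) i p < w₂)
      poor? p i = Fresh? σ p ×-dec (onLine (Fresh? σ) i p <? w₂)
      per-point : ∀ p (S? : Dec _) → 𝟙 {P = touched σ p < r + r × ∑ dirs (𝟙 ∘ Rich₂? σ p) < d} S? * d
                  ≤ ∑[ i ← dirs ] 𝟙 (poor? p i)
      per-point p (no _) = z≤n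
      per-point p (yes (fresh , few)) = begin
        1 * d ≡⟨ *-identityˡ d ⟩
        d ≤⟨ +-cancelˡ-≤ d _ _ (begin
          d + d           ≡⟨ D≡d+d ⟨
          D               ≡⟨ *-identityʳ D ⟨
          D * 1           ≡⟨ ∑-allFin-const D 1 ⟨
          ∑[ i ← dirs ] 1
            ≤⟨ ∑-mono dirs (λ i → 𝟙-⊎ (yes fresh) (Rich₂? σ p i) (poor? p i) (λ f w≰ → f , ≰⇒> w≰)) ⟩
          ∑[ i ← dirs ] (𝟙 (Rich₂? σ p i) + 𝟙 (poor? p i)) ≡⟨ ∑-+ dirs _ _ ⟩
          ∑ dirs (𝟙 ∘ Rich₂? σ p) + ∑[ i ← dirs ] 𝟙 (poor? p i) ≤⟨ +-monoˡ-≤ _ (<⇒≤ few) ⟩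
          d + ∑[ i ← dirs ] 𝟙 (poor? p i) ∎) ⟩
        ∑[ i ← dirs ] 𝟙 (poor? p i) ∎

    -- With `r + r` touched directions, not being stuck means having `r` killers. Otherwise at least
    -- `d` directions are rich and fewer than `r + r` of them are touched, which leaves
    -- `d ∸ (r + r)` spreaders.
    progress : ∀ σ p → Alive σ p → ¬ (r + r ≤ touched σ p × ∑ dirs (𝟙 ∘ Killer? σ p) < r) →
               ¬ (touched σ p < r + r × ∑ dirs (𝟙 ∘ Rich₂? σ p) < d) →
               aliveCount (p ∷ σ) + κ₁ ≤ aliveCount σ ⊎ slack (p ∷ σ) + κ₂ ≤ slack σ
    progress σ p al ¬s₁ ¬s₂ with r + r ≤? touched σ p
    ... | yes many = inj₁ (kill σ p (≮⇒≥ λ few → ¬s₁ (many , few)))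
    ... | no ≰ = inj₂ (spread σ p (m≤n+o⇒m∸n≤o d (r + r) (begin
        d ≤⟨ ≮⇒≥ (λ few → ¬s₂ (≰⇒> ≰ , few)) ⟩
        ∑ dirs (𝟙 ∘ Rich₂? σ p)
          ≤⟨ ∑-mono dirs (λ i → 𝟙-⊎ (Rich₂? σ p i) (1 ≤? hits σ i p) (Spreader? σ p i) (λ rich unhit → ≰⇒> unhit , rich)) ⟩
        ∑[ i ← dirs ] (𝟙 (1 ≤? hits σ i p) + 𝟙 (Spreader? σ p i)) ≡⟨ ∑-+ dirs _ _ ⟩
        touched σ p + ∑ dirs (𝟙 ∘ Spreader? σ p) ≤⟨ +-monoˡ-≤ _ (<⇒≤ (≰⇒> ≰)) ⟩
        r + r + ∑ dirs (𝟙 ∘ Spreader? σ p) ∎)))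
      where open ≤-Reasoning

-- Sequences and their subsequences

module _ {A : Set} (L : List A) where

  -- The head of a vector is its newest term. Summing over it innermost amounts to averaging over
  -- the next point with all earlier points fixed.
  vectors : ∀ n → List (Vec A n)
  vectors zero    = [] ∷ []
  vectors (suc n) = cartesianProductWith (λ v x → x ∷ v) (vectors n) L

  ∑-vectors : ∀ n (f : Vec A (suc n) → ℕ) → ∑ (vectors (suc n)) f ≡ ∑[ v ← vectors n ] ∑[ x ← L ] f (x ∷ v)
  ∑-vectors n f = ∑-cartesianProductWith (λ v x → x ∷ v) (vectors n) L f

  length-vectors : ∀ n → length (vectors n) ≡ length L ^ n
  length-vectors zero    = refl
  length-vectors (suc n) = begin
    length (vectors (suc n))                    ≡⟨ length≡∑ (vectors (suc n)) ⟩
    ∑[ _ ← vectors (suc n) ] 1                  ≡⟨ ∑-vectors n _ ⟩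
    ∑[ v ← vectors n ] ∑[ x ← L ] 1             ≡⟨ ∑-const (vectors n) _ ⟩
    length (vectors n) * ∑[ x ← L ] 1           ≡⟨ cong₂ _*_ (length-vectors n) (sym (length≡∑ L)) ⟩
    length L ^ n * length L                     ≡⟨ *-comm (length L ^ n) _ ⟩
    length L * length L ^ n ∎
    where
    open ≡-Reasoning
    length≡∑ : ∀ {B : Set} (K : List B) → length K ≡ ∑[ _ ← K ] 1
    length≡∑ K = sym (trans (∑-const K 1) (*-identityʳ _))

  ∈-vectors : (∀ x → x ∈ₗ L) → ∀ {n} (v : Vec A n) → v ∈ₗ vectors n
  ∈-vectors all []      = here refl
  ∈-vectors all (x ∷ v) = ∈-cartesianProductWith⁺ (λ v x → x ∷ v) (∈-vectors all v) (all x)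

subsets : ∀ n → List (Subset n)
subsets = vectors (true ∷ false ∷ [])

∈-subsets : ∀ {n} (S : Subset n) → S ∈ₗ subsets n
∈-subsets = ∈-vectors _ λ { true → here refl ; false → there (here refl) }

select : ∀ {A : Set} {n} → Subset n → Vec A n → List A
select []          []      = []
select (true ∷ S)  (x ∷ v) = x ∷ select S v
select (false ∷ S) (x ∷ v) = select S v

length-select : ∀ {A : Set} {n} (S : Subset n) (v : Vec A n) → length (select S v) ≡ ∣ S ∣
length-select []          []      = refl
length-select (true ∷ S)  (x ∷ v) = cong suc (length-select S v)
length-select (false ∷ S) (x ∷ v) = length-select S v

/-drop : ∀ {x x′} κ .{{_ : NonZero κ}} → x′ + κ ≤ x → suc (x′ / κ) ≤ x / κ
/-drop {x} {x′} κ le = begin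
  suc (x′ / κ)        ≤⟨ s≤s (/-monoˡ-≤ κ (m+n≤o⇒m≤o∸n x′ le)) ⟩
  suc ((x ∸ κ) / κ)   ≡⟨ m/n≡1+[m∸n]/n {x} {κ} (≤-trans (m≤n+m κ x′) le) ⟨
  x / κ ∎
  where open ≤-Reasoning

-- Weights of triple-free subsequences of random sequences

module Sequences {D m : ℕ} (LS : LineSystem D m) where
  open Lines LS public

  -- Points are chosen from the tail towards the head, so each selected point is tested against the
  -- selected points behind it.
  TripleFree : ∀ {n} → Subset n → Vec Q n → Set
  TripleFree []          []      = ⊤
  TripleFree (true ∷ S)  (q ∷ v) = Alive (select S v) q × TripleFree S v
  TripleFree (false ∷ S) (q ∷ v) = TripleFree S v

  tripleFree? : ∀ {n} (S : Subset n) (v : Vec Q n) → Dec (TripleFree S v)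
  tripleFree? []          []      = yes tt
  tripleFree? (true ∷ S)  (q ∷ v) = alive? (select S v) q ×-dec tripleFree? S v
  tripleFree? (false ∷ S) (q ∷ v) = tripleFree? S v

  module Counting (d r w₁ w₂ : ℕ) (D≡d+d : D ≡ d + d) where
    open Potential d r w₁ w₂ D≡d+d

    module Weights (y n₀ : ℕ)
      .{{_ : NonZero d}} .{{_ : NonZero r}} .{{_ : NonZero m}} .{{_ : NonZero y}}
      .{{_ : NonZero κ₁}} .{{_ : NonZero κ₂}}
      (few₁ : (y + y) * (n₀ * (D * w₁)) ≤ M * r)
      (few₂ : (y + y) * (w₂ + w₂) ≤ m) where

      -- Bounds the number of further productive choices, since each of them lowers one of the two
      -- quotients by at least 1.
      potential : List Q → ℕ
      potential σ = aliveCount σ / κ₁ + slack σ / κ₂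

      exceptions : List Q → Q → ℕ
      exceptions σ p = 𝟙 (Stuck₁? σ p) + 𝟙 (Stuck₂? σ p)

      -- By `few₁` and `few₂` each of the two stuck sets has density at most `1/(y + y)`.
      exceptions-few : ∀ σ → length σ ≤ n₀ → y * ∑ pts (exceptions σ) ≤ M
      exceptions-few σ le = *-cancelʳ-≤ _ _ 2 (begin
        y * ∑ pts (exceptions σ) * 2            ≡⟨ cong (λ z → y * z * 2) (∑-+ pts _ _) ⟩
        y * (e₁ + e₂) * 2                       ≡⟨ split y e₁ e₂ ⟩
        (y + y) * e₁ + (y + y) * e₂             ≤⟨ +-mono-≤ bound₁ bound₂ ⟩
        M + M                                   ≡⟨ double M ⟩
        M * 2 ∎)
        where
        open ≤-Reasoning
        e₁ = ∑ pts (𝟙 ∘ Stuck₁? σ)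
        e₂ = ∑ pts (𝟙 ∘ Stuck₂? σ)
        split : ∀ y a b → y * (a + b) * 2 ≡ (y + y) * a + (y + y) * b
        split = solve-∀
        double : ∀ a → a + a ≡ a * 2
        double = solve-∀
        regroup : ∀ y e d m → (y + y) * e * (d * m) ≡ (y + y) * (m * (e * d))
        regroup = solve-∀
        regroup′ : ∀ y d M w → (y + y) * ((d + d) * (M * w)) ≡ (M * d) * ((y + y) * (w + w))
        regroup′ = solve-∀
        bound₁ : (y + y) * e₁ ≤ M
        bound₁ = *-cancelʳ-≤ _ _ r (begin
          (y + y) * e₁ * r                      ≡⟨ *-assoc (y + y) e₁ r ⟩
          (y + y) * (e₁ * r)                    ≤⟨ *-monoʳ-≤ (y + y) (Stuck₁-few σ) ⟩
          (y + y) * (length σ * (D * w₁))       ≤⟨ *-monoʳ-≤ (y + y) (*-monoˡ-≤ (D * w₁) le) ⟩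
          (y + y) * (n₀ * (D * w₁))             ≤⟨ few₁ ⟩
          M * r ∎)
        bound₂ : (y + y) * e₂ ≤ M
        bound₂ = *-cancelʳ-≤ _ _ (d * m) {{m*n≢0 d m}} (begin
          (y + y) * e₂ * (d * m)                ≡⟨ regroup y e₂ d m ⟩
          (y + y) * (m * (e₂ * d))              ≤⟨ *-monoʳ-≤ (y + y) (Stuck₂-few σ) ⟩
          (y + y) * (D * (M * w₂))              ≡⟨ cong (λ z → (y + y) * (z * (M * w₂))) D≡d+d ⟩
          (y + y) * ((d + d) * (M * w₂))        ≡⟨ regroup′ y d M w₂ ⟩
          M * d * ((y + y) * (w₂ + w₂))         ≤⟨ *-monoʳ-≤ (M * d) few₂ ⟩
          M * d * m                             ≡⟨ *-assoc M d m ⟩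
          M * (d * m) ∎)

      potential-∷ : ∀ p σ → potential (p ∷ σ) ≤ potential σ
      potential-∷ p σ = +-mono-≤ (/-monoˡ-≤ κ₁ (aliveCount-∷ p σ)) (/-monoˡ-≤ κ₂ (slack-∷ p σ))

      potential-drop : ∀ σ p → Alive σ p → ¬ (r + r ≤ touched σ p × ∑ dirs (𝟙 ∘ Killer? σ p) < r) →
                       ¬ (touched σ p < r + r × ∑ dirs (𝟙 ∘ Rich₂? σ p) < d) →
                       suc (potential (p ∷ σ)) ≤ potential σ
      potential-drop σ p al ¬s₁ ¬s₂ with progress σ p al ¬s₁ ¬s₂
      ... | inj₁ k = +-mono-≤ (/-drop κ₁ k) (/-monoˡ-≤ κ₂ (slack-∷ p σ))
      ... | inj₂ s = ≤-trans (≤-reflexive (sym (+-suc _ _))) (+-mono-≤ (/-monoˡ-≤ κ₁ (aliveCount-∷ p σ)) (/-drop κ₂ s))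

      -- A productive choice pays for the additional factor `y` with a drop of the potential. An
      -- exceptional choice need not lower the potential and is charged the full factor `y`.
      growth-point : ∀ σ p → 𝟙 (alive? σ p) * y ^ suc (potential (p ∷ σ)) ≤ (y * exceptions σ p + 1) * y ^ potential σ
      growth-point σ p with alive? σ p | Stuck₁? σ p | Stuck₂? σ p
      ... | no _   | _       | _      = z≤n
      ... | yes al | yes _   | s₂     = begin
        1 * (y * y ^ potential (p ∷ σ))   ≡⟨ *-identityˡ _ ⟩
        y * y ^ potential (p ∷ σ)         ≤⟨ *-mono-≤ (≤-trans (m≤m*n y (suc (𝟙 s₂))) (m≤m+n _ 1)) (^-monoʳ-≤ y (potential-∷ p σ)) ⟩
        (y * suc (𝟙 s₂) + 1) * y ^ potential σ ∎
        where open ≤-Reasoning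
      ... | yes al | no _    | yes _  = begin
        1 * (y * y ^ potential (p ∷ σ))   ≡⟨ *-identityˡ _ ⟩
        y * y ^ potential (p ∷ σ)         ≤⟨ *-mono-≤ (≤-trans (m≤m*n y 1) (m≤m+n _ 1)) (^-monoʳ-≤ y (potential-∷ p σ)) ⟩
        (y * 1 + 1) * y ^ potential σ ∎
        where open ≤-Reasoning
      ... | yes al | no ¬s₁  | no ¬s₂ = begin
        1 * y ^ suc (potential (p ∷ σ))
          ≤⟨ *-monoʳ-≤ 1 (^-monoʳ-≤ y (potential-drop σ p al (λ (m , f) → ¬s₁ ((al , m) , f)) ¬s₂)) ⟩
        1 * y ^ potential σ               ≡⟨ cong (λ z → (z + 1) * y ^ potential σ) (*-zeroʳ y) ⟨
        (y * 0 + 1) * y ^ potential σ ∎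
        where open ≤-Reasoning

      -- Exceptional points have density at most `1/y`, so their factor `y` adds no more than
      -- another `M` to the sum.
      growth : ∀ σ → length σ ≤ n₀ → ∑[ p ← pts ] (𝟙 (alive? σ p) * y ^ suc (potential (p ∷ σ))) ≤ 2 * M * y ^ potential σ
      growth σ le = begin
        ∑[ p ← pts ] (𝟙 (alive? σ p) * y ^ suc (potential (p ∷ σ))) ≤⟨ ∑-mono pts (growth-point σ) ⟩
        ∑[ p ← pts ] ((y * exceptions σ p + 1) * X)   ≡⟨ ∑-*ʳ pts X _ ⟩
        ∑[ p ← pts ] (y * exceptions σ p + 1) * X     ≡⟨ cong (_* X) (∑-+ pts _ _) ⟩
        (∑[ p ← pts ] (y * exceptions σ p) + ∑[ _ ← pts ] 1) * X
          ≡⟨ cong₂ (λ a b → (a + b) * X) (∑-*ˡ pts y _) (trans (∑-const pts 1) (*-identityʳ M)) ⟩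
        (y * ∑ pts (exceptions σ) + M) * X            ≤⟨ *-monoˡ-≤ X (+-monoˡ-≤ M (exceptions-few σ le)) ⟩
        (M + M) * X                                   ≡⟨ cong (λ z → (M + z) * X) (+-identityʳ M) ⟨
        2 * M * X ∎
        where
        open ≤-Reasoning
        X = y ^ potential σ

      -- The exponent, chosen points plus remaining potential, rises only at exceptional choices,
      -- and then by at most 1.
      weight : ∀ {n} → Vec Q n → Subset n → ℕ
      weight v S = 𝟙 (tripleFree? S v) * y ^ (∣ S ∣ + potential (select S v))

      totalWeight : ∀ {n} → Vec Q n → ℕ
      totalWeight v = ∑ (subsets _) (weight v)

      -- Skipping the new term contributes `M` and choosing it at most `2 * M`, by `growth`. The
      -- summand `0` is the end of the sum over the two values of the new bit.
      weight-step : ∀ {n} (v : Vec Q n) (S : Subset n) → n ≤ n₀ →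
        ∑[ q ← pts ] (weight (q ∷ v) (true ∷ S) + (weight (q ∷ v) (false ∷ S) + 0)) ≤ 3 * M * weight v S
      weight-step v S n≤ = begin
        ∑[ q ← pts ] (weight (q ∷ v) (true ∷ S) + (weight (q ∷ v) (false ∷ S) + 0))
          ≡⟨ ∑-cong pts (λ q → cong₂ _+_ (factor q) (+-identityʳ _)) ⟩
        ∑[ q ← pts ] (T * (𝟙 (alive? σ q) * y ^ suc (potential (q ∷ σ))) + weight v S)
          ≡⟨ trans (∑-+ pts _ _) (cong₂ _+_ (∑-*ˡ pts T _) (∑-const pts _)) ⟩
        T * ∑[ q ← pts ] (𝟙 (alive? σ q) * y ^ suc (potential (q ∷ σ))) + M * weight v S
          ≤⟨ +-monoˡ-≤ _ (*-monoʳ-≤ T (growth σ (≤-trans (≤-reflexive (length-select S v)) (≤-trans (∣p∣≤n S) n≤)))) ⟩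
        T * (2 * M * y ^ potential σ) + M * (t * y ^ (∣ S ∣ + potential σ))
          ≡⟨ cong (λ z → T * (2 * M * y ^ potential σ) + M * (t * z)) (^-distribˡ-+-* y ∣ S ∣ _) ⟩
        T * (2 * M * y ^ potential σ) + M * (t * (y ^ ∣ S ∣ * y ^ potential σ))
          ≡⟨ collect t (y ^ ∣ S ∣) M (y ^ potential σ) ⟩
        3 * M * (t * (y ^ ∣ S ∣ * y ^ potential σ))
          ≡⟨ cong (λ z → 3 * M * (t * z)) (^-distribˡ-+-* y ∣ S ∣ _) ⟨
        3 * M * weight v S ∎
        where
        open ≤-Reasoning
        σ = select S v
        t = 𝟙 (tripleFree? S v)
        T = t * y ^ ∣ S ∣
        collect : ∀ t a M b → t * a * (2 * M * b) + M * (t * (a * b)) ≡ 3 * M * (t * (a * b))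
        collect = solve-∀
        shuffle : ∀ y a t c b → a * t * (y * (c * b)) ≡ t * c * (a * (y * b))
        shuffle = solve-∀
        factor : ∀ q → weight (q ∷ v) (true ∷ S) ≡ T * (𝟙 (alive? σ q) * y ^ suc (potential (q ∷ σ)))
        factor q = trans (cong₂ _*_ (𝟙-× (alive? σ q) (tripleFree? S v)) (cong (y *_) (^-distribˡ-+-* y ∣ S ∣ _)))
                         (shuffle y (𝟙 (alive? σ q)) t (y ^ ∣ S ∣) _)

      totalWeight-sum : ∀ n → n ≤ n₀ → ∑ (vectors pts n) totalWeight ≤ (3 * M) ^ n * y ^ potential []
      totalWeight-sum zero    _  = ≤-reflexive (trans (+-identityʳ _) (+-identityʳ _))
      totalWeight-sum (suc n) n< = begin
        ∑ (vectors pts (suc n)) totalWeight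
          ≡⟨ ∑-vectors pts n totalWeight ⟩
        ∑[ v ← vectors pts n ] ∑[ q ← pts ] totalWeight (q ∷ v)
          ≡⟨ ∑-cong (vectors pts n) (λ v → trans (∑-cong pts λ q → ∑-vectors _ n (weight (q ∷ v))) (∑-swap pts (subsets n) _)) ⟩
        ∑[ v ← vectors pts n ] ∑[ S ← subsets n ] ∑[ q ← pts ] (weight (q ∷ v) (true ∷ S) + (weight (q ∷ v) (false ∷ S) + 0))
          ≤⟨ ∑-mono (vectors pts n) (λ v → ∑-mono (subsets n) λ S → weight-step v S (<⇒≤ n<)) ⟩
        ∑[ v ← vectors pts n ] ∑[ S ← subsets n ] (3 * M * weight v S)
          ≡⟨ ∑-cong (vectors pts n) (λ v → ∑-*ˡ (subsets n) (3 * M) (weight v)) ⟩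
        ∑[ v ← vectors pts n ] (3 * M * totalWeight v)
          ≡⟨ ∑-*ˡ (vectors pts n) (3 * M) totalWeight ⟩
        3 * M * ∑ (vectors pts n) totalWeight
          ≤⟨ *-monoʳ-≤ (3 * M) (totalWeight-sum n (<⇒≤ n<)) ⟩
        3 * M * ((3 * M) ^ n * y ^ potential [])
          ≡⟨ *-assoc (3 * M) _ _ ⟨
        (3 * M) ^ suc n * y ^ potential [] ∎
        where open ≤-Reasoning

      tripleFree-weight : ∀ {n} (v : Vec Q n) (S : Subset n) → TripleFree S v → y ^ ∣ S ∣ ≤ totalWeight v
      tripleFree-weight v S tf = begin
        y ^ ∣ S ∣                             ≤⟨ ^-monoʳ-≤ y (m≤m+n ∣ S ∣ _) ⟩
        y ^ (∣ S ∣ + potential (select S v))  ≡⟨ *-identityˡ _ ⟨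
        1 * y ^ (∣ S ∣ + potential (select S v)) ≡⟨ cong (_* y ^ (∣ S ∣ + potential (select S v))) (𝟙-true (tripleFree? S v) tf) ⟨
        weight v S                            ≤⟨ term≤∑ (weight v) (∈-subsets S) ⟩
        totalWeight v ∎
        where open ≤-Reasoning

  -- Deletion of repeated terms and of terms on crowded lines

  Bad : List Q → Q → Set
  Bad σ q = q ∈ₗ σ ⊎ ∃ λ i → 3 ≤ hits σ i q

  bad? : ∀ σ q → Dec (Bad σ q)
  bad? σ q = Any.any? (q ≟Q_) σ ⊎-dec any? (λ i → 3 ≤? hits σ i q)

  badCount : ∀ {n} → Vec Q n → ℕ
  badCount []      = 0
  badCount (q ∷ v) = 𝟙 (bad? (toList v) q) + badCount v

  -- The number of r-element subsequences of σ on the i-th line through q; unlike powers of hits, its sums are exact products.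
  tuples : ℕ → Fin D → Q → List Q → ℕ
  tuples zero    i q σ       = 1
  tuples (suc r) i q []      = 0
  tuples (suc r) i q (p ∷ σ) = 𝟙 (sim? p i q) * tuples r i q σ + tuples (suc r) i q σ

  hits⇒tuples : ∀ r i q σ → r ≤ hits σ i q → 1 ≤ tuples r i q σ
  hits⇒tuples zero    i q σ       _  = ≤-refl
  hits⇒tuples (suc r) i q (p ∷ σ) le with sim? p i q
  ... | yes _ = ≤-trans (hits⇒tuples r i q σ (≤-pred le)) (≤-trans (≤-reflexive (sym (*-identityˡ _))) (m≤m+n _ _))
  ... | no _  = hits⇒tuples (suc r) i q σ le

  -- A first-moment bound with denominators cleared: the expected number of `r`-tuples is at most
  -- `(n * m / M) ^ r`. In the induction the newest term hits the line for `m` of its `M` values.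
  tuples-sum : ∀ r i q n → ∑[ v ← vectors pts n ] tuples r i q (toList v) * M ^ r ≤ (n * m) ^ r * M ^ n
  tuples-sum zero i q n = ≤-reflexive (trans (*-identityʳ _)
    (trans (∑-const (vectors pts n) 1) (trans (*-identityʳ _) (trans (length-vectors pts n) (sym (*-identityˡ _))))))
  tuples-sum (suc r) i q zero = z≤n
  tuples-sum (suc r) i q (suc n) = begin
    ∑[ v ← vectors pts (suc n) ] tuples (suc r) i q (toList v) * M ^ suc r
      ≡⟨ cong (_* M ^ suc r) (trans (∑-vectors pts n _) (∑-cong (vectors pts n) λ v →
           trans (∑-+ pts _ _) (cong₂ _+_ (trans (∑-*ʳ pts _ _) (cong (_* tuples r i q (toList v)) (line-size i q))) (∑-const pts _)))) ⟩
    ∑[ v ← vectors pts n ] (m * tuples r i q (toList v) + M * tuples (suc r) i q (toList v)) * M ^ suc r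
      ≡⟨ cong (_* M ^ suc r) (trans (∑-+ (vectors pts n) _ _) (cong₂ _+_ (∑-*ˡ (vectors pts n) m _) (∑-*ˡ (vectors pts n) M _))) ⟩
    (m * s₀ + M * s₁) * (M * M ^ r)
      ≡⟨ expand m M s₀ s₁ (M ^ r) ⟩
    m * M * (s₀ * M ^ r) + M * (s₁ * (M * M ^ r))
      ≤⟨ +-mono-≤ (*-monoʳ-≤ (m * M) (tuples-sum r i q n)) (*-monoʳ-≤ M (tuples-sum (suc r) i q n)) ⟩
    m * M * ((n * m) ^ r * M ^ n) + M * (n * m * (n * m) ^ r * M ^ n)
      ≡⟨ gather m M n ((n * m) ^ r) (M ^ n) ⟩
    suc n * m * (n * m) ^ r * (M * M ^ n)
      ≤⟨ *-monoˡ-≤ (M * M ^ n) (*-monoʳ-≤ (suc n * m) (^-monoˡ-≤ r (*-monoˡ-≤ m (n≤1+n n)))) ⟩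
    (suc n * m) ^ suc r * M ^ suc n ∎
    where
    open ≤-Reasoning
    s₀ = ∑[ v ← vectors pts n ] tuples r i q (toList v)
    s₁ = ∑[ v ← vectors pts n ] tuples (suc r) i q (toList v)
    expand : ∀ m M a b c → (m * a + M * b) * (M * c) ≡ m * M * (a * c) + M * (b * (M * c))
    expand = solve-∀
    gather : ∀ m M n a b → m * M * (a * b) + M * (n * m * a * b) ≡ suc n * m * a * (M * b)
    gather = solve-∀

  -- A union bound: repetitions account for at most one point per term of `σ`, and a point with
  -- three hits on a line is counted by an earlier triple there.
  bad-points : ∀ σ → ∑[ q ← pts ] 𝟙 (bad? σ q) ≤ length σ + ∑[ q ← pts ] ∑[ i ← dirs ] tuples 3 i q σ
  bad-points σ = begin
    ∑[ q ← pts ] 𝟙 (bad? σ q)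
      ≤⟨ ∑-mono pts per-point ⟩
    ∑[ q ← pts ] (∑[ s ← σ ] 𝟙 (q ≟Q s) + ∑[ i ← dirs ] tuples 3 i q σ)
      ≡⟨ ∑-+ pts _ _ ⟩
    ∑[ q ← pts ] ∑[ s ← σ ] 𝟙 (q ≟Q s) + ∑[ q ← pts ] ∑[ i ← dirs ] tuples 3 i q σ
      ≤⟨ +-monoˡ-≤ _ coincidences ⟩
    length σ + ∑[ q ← pts ] ∑[ i ← dirs ] tuples 3 i q σ ∎
    where
    open ≤-Reasoning
    coincidences : ∑[ q ← pts ] ∑[ s ← σ ] 𝟙 (q ≟Q s) ≤ length σ
    coincidences = begin
      ∑[ q ← pts ] ∑[ s ← σ ] 𝟙 (q ≟Q s)  ≡⟨ ∑-swap pts σ _ ⟩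
      ∑[ s ← σ ] ∑[ q ← pts ] 𝟙 (q ≟Q s)  ≤⟨ ∑-mono σ (λ s → ∑-𝟙-unique (_≟Q s) unique λ a b → trans a (sym b)) ⟩
      ∑[ s ← σ ] 1                         ≡⟨ trans (∑-const σ 1) (*-identityʳ _) ⟩
      length σ ∎
    per-point : ∀ q → 𝟙 (bad? σ q) ≤ ∑[ s ← σ ] 𝟙 (q ≟Q s) + ∑[ i ← dirs ] tuples 3 i q σ
    per-point q with bad? σ q
    ... | no _ = z≤n
    ... | yes (inj₁ q∈σ) = ≤-trans (≤-trans (≤-reflexive (sym (𝟙-true (q ≟Q q) refl))) (term≤∑ (λ s → 𝟙 (q ≟Q s)) q∈σ)) (m≤m+n _ _)
    ... | yes (inj₂ (i , h)) = ≤-trans (≤-trans (hits⇒tuples 3 i q σ h) (term≤∑ (λ i → tuples 3 i q σ) (∈-allFin i))) (m≤n+m _ _)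

  module Deletion (n₀ u : ℕ) .{{_ : NonZero D}} .{{_ : NonZero M}}
    (volume : n₀ * (u * m) ≤ M) (sparse : 8 * D ≤ u ^ 3) (thin : 8 * n₀ ≤ M) where

    -- By `volume` the expected number of terms on a given line is at most `1/u`, so that of triples
    -- is at most `1/u³`.
    triples-rare : ∀ i q n → n ≤ n₀ → ∑[ v ← vectors pts n ] tuples 3 i q (toList v) * u ^ 3 ≤ M ^ n
    triples-rare i q n n≤ = *-cancelʳ-≤ _ _ (M ^ 3) {{m^n≢0 M 3}} (begin
      s * u ^ 3 * M ^ 3          ≡⟨ swap₃ s (u ^ 3) (M ^ 3) ⟩
      s * M ^ 3 * u ^ 3          ≤⟨ *-monoˡ-≤ (u ^ 3) (tuples-sum 3 i q n) ⟩
      (n * m) ^ 3 * M ^ n * u ^ 3 ≡⟨ cubes n m u (M ^ n) ⟩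
      M ^ n * (n * (u * m)) ^ 3  ≤⟨ *-monoʳ-≤ (M ^ n) (^-monoˡ-≤ 3 (≤-trans (*-monoˡ-≤ (u * m) n≤) volume)) ⟩
      M ^ n * M ^ 3 ∎)
      where
      open ≤-Reasoning
      s = ∑[ v ← vectors pts n ] tuples 3 i q (toList v)
      swap₃ : ∀ a b c → a * b * c ≡ a * c * b
      swap₃ = solve-∀
      cubes : ∀ n m u X → (n * m) * ((n * m) * ((n * m) * 1)) * X * (u * (u * (u * 1)))
              ≡ X * ((n * (u * m)) * ((n * (u * m)) * ((n * (u * m)) * 1)))
      cubes = solve-∀

    -- The newest term is a repetition with probability at most 1/8 by `thin`, and crowds one of its
    -- `D` lines with probability at most 1/8 by `sparse`. On average at most a quarter of the terms
    -- are bad.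
    badCount-sum : ∀ n → n ≤ n₀ → 4 * ∑ (vectors pts n) badCount ≤ n * M ^ n
    badCount-sum zero    _  = z≤n
    badCount-sum (suc n) n< = *-cancelˡ-≤ 2 (begin
      2 * (4 * ∑ (vectors pts (suc n)) badCount)
        ≡⟨ cong (λ z → 2 * (4 * z)) (trans (∑-vectors pts n badCount) (trans (∑-cong V λ v →
             trans (∑-+ pts _ _) (cong (∑ pts (𝟙 ∘ bad? (toList v)) +_) (∑-const pts (badCount v))))
             (trans (∑-+ V _ _) (cong (∑[ v ← V ] ∑ pts (𝟙 ∘ bad? (toList v)) +_) (∑-*ˡ V M badCount))))) ⟩
      2 * (4 * (∑[ v ← V ] ∑ pts (𝟙 ∘ bad? (toList v)) + M * ∑ V badCount))
        ≡⟨ distribute (∑[ v ← V ] ∑ pts (𝟙 ∘ bad? (toList v))) M (∑ V badCount) ⟩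
      8 * ∑[ v ← V ] ∑ pts (𝟙 ∘ bad? (toList v)) + 2 * (M * (4 * ∑ V badCount))
        ≤⟨ +-mono-≤ new (*-monoʳ-≤ 2 (*-monoʳ-≤ M (badCount-sum n (<⇒≤ n<)))) ⟩
      2 * (M * M ^ n) + 2 * (M * (n * M ^ n))
        ≡⟨ recombine M n (M ^ n) ⟩
      2 * (suc n * M ^ suc n) ∎)
      where
      open ≤-Reasoning
      V = vectors pts n
      distribute : ∀ a M b → 2 * (4 * (a + M * b)) ≡ 8 * a + 2 * (M * (4 * b))
      distribute = solve-∀
      recombine : ∀ M n X → 2 * (M * X) + 2 * (M * (n * X)) ≡ 2 * (suc n * (M * X))
      recombine = solve-∀
      per-line : ∀ q i → D * (8 * ∑[ v ← V ] tuples 3 i q (toList v)) ≤ M ^ n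
      per-line q i = begin
        D * (8 * s)  ≡⟨ rearrange D s ⟩
        s * (8 * D)  ≤⟨ *-monoʳ-≤ s sparse ⟩
        s * u ^ 3    ≤⟨ triples-rare i q n (<⇒≤ n<) ⟩
        M ^ n ∎
        where
        s = ∑[ v ← V ] tuples 3 i q (toList v)
        rearrange : ∀ D s → D * (8 * s) ≡ s * (8 * D)
        rearrange = solve-∀
      collinearities : 8 * ∑[ v ← V ] ∑[ q ← pts ] ∑[ i ← dirs ] tuples 3 i q (toList v) ≤ M * M ^ n
      collinearities = *-cancelˡ-≤ D (begin
        D * (8 * ∑[ v ← V ] ∑[ q ← pts ] ∑[ i ← dirs ] tuples 3 i q (toList v))
          ≡⟨ cong (λ z → D * (8 * z)) (trans (∑-swap V pts _) (∑-cong pts λ q → ∑-swap V dirs _)) ⟩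
        D * (8 * ∑[ q ← pts ] ∑[ i ← dirs ] ∑[ v ← V ] tuples 3 i q (toList v))
          ≡⟨ *-assoc D 8 _ ⟨
        D * 8 * ∑[ q ← pts ] ∑[ i ← dirs ] ∑[ v ← V ] tuples 3 i q (toList v)
          ≡⟨ trans (sym (∑-*ˡ pts (D * 8) _)) (∑-cong pts λ q → sym (∑-*ˡ dirs (D * 8) _)) ⟩
        ∑[ q ← pts ] ∑[ i ← dirs ] (D * 8 * ∑[ v ← V ] tuples 3 i q (toList v))
          ≤⟨ ∑-mono pts (λ q → ∑-mono dirs λ i → ≤-trans (≤-reflexive (*-assoc D 8 _)) (per-line q i)) ⟩
        ∑[ q ← pts ] ∑[ i ← dirs ] (M ^ n)
          ≡⟨ trans (∑-cong pts λ q → ∑-allFin-const D _) (∑-const pts _) ⟩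
        M * (D * M ^ n)
          ≡⟨ exchange M D (M ^ n) ⟩
        D * (M * M ^ n) ∎)
        where
        exchange : ∀ a b c → a * (b * c) ≡ b * (a * c)
        exchange = solve-∀
      new : 8 * ∑[ v ← V ] ∑ pts (𝟙 ∘ bad? (toList v)) ≤ 2 * (M * M ^ n)
      new = begin
        8 * ∑[ v ← V ] ∑ pts (𝟙 ∘ bad? (toList v))
          ≤⟨ *-monoʳ-≤ 8 (∑-mono V λ v → bad-points (toList v)) ⟩
        8 * ∑[ v ← V ] (length (toList v) + ∑[ q ← pts ] ∑[ i ← dirs ] tuples 3 i q (toList v))
          ≡⟨ cong (8 *_) (∑-+ V _ _) ⟩
        8 * (∑[ v ← V ] length (toList v) + ∑[ v ← V ] ∑[ q ← pts ] ∑[ i ← dirs ] tuples 3 i q (toList v))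
          ≡⟨ *-distribˡ-+ 8 (∑[ v ← V ] length (toList v)) _ ⟩
        8 * ∑[ v ← V ] length (toList v) + 8 * ∑[ v ← V ] ∑[ q ← pts ] ∑[ i ← dirs ] tuples 3 i q (toList v)
          ≤⟨ +-monoʳ-≤ _ collinearities ⟩
        8 * ∑[ v ← V ] length (toList v) + M * M ^ n
          ≡⟨ cong (λ z → 8 * z + M * M ^ n) (trans (∑-cong V length-toList)
               (trans (∑-const V n) (cong (_* n) (length-vectors pts n)))) ⟩
        8 * (M ^ n * n) + M * M ^ n
          ≡⟨ cong (_+ M * M ^ n) (rotate (M ^ n) n) ⟩
        8 * n * M ^ n + M * M ^ n
          ≤⟨ +-monoˡ-≤ _ (*-monoˡ-≤ (M ^ n) (≤-trans (*-monoʳ-≤ 8 (<⇒≤ n<)) thin)) ⟩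
        M * M ^ n + M * M ^ n
          ≡⟨ cong (M * M ^ n +_) (+-identityʳ _) ⟨
        2 * (M * M ^ n) ∎
        where
        rotate : ∀ a b → 8 * (a * b) ≡ 8 * b * a
        rotate = solve-∀

^-distribʳ-* : ∀ e a b → (a * b) ^ e ≡ a ^ e * b ^ e
^-distribʳ-* zero    a b = refl
^-distribʳ-* (suc e) a b = trans (cong (a * b *_) (^-distribʳ-* e a b)) (interchange a b (a ^ e) (b ^ e))
  where interchange : ∀ a b c d → a * b * (c * d) ≡ a * c * (b * d)
        interchange = solve-∀

-- Existence of a sequence with few bad terms and no large triple-free subsequence

module Existence {D m : ℕ} (LS : LineSystem D m) where
  open Sequences LS

  module _ (k d r w₁ w₂ n u : ℕ) (D≡d+d : D ≡ d + d) where
    open Potential d r w₁ w₂ D≡d+d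
    open Counting d r w₁ w₂ D≡d+d

    y : ℕ
    y = 3 ^ (4 * k)

    private instance
      y≢0 : NonZero y
      y≢0 = m^n≢0 3 (4 * k)

    module _
      .{{_ : NonZero k}} .{{_ : NonZero d}} .{{_ : NonZero r}} .{{_ : NonZero m}} .{{_ : NonZero D}} .{{_ : NonZero M}}
      .{{_ : NonZero n}} .{{_ : NonZero κ₁}} .{{_ : NonZero κ₂}}
      (few₁ : (y + y) * (n * (D * w₁)) ≤ M * r)
      (few₂ : (y + y) * (w₂ + w₂) ≤ m)
      (volume : n * (u * m) ≤ M) (sparse : 8 * D ≤ u ^ 3) (thin : 8 * n ≤ M)
      (kills : 4 * k * M ≤ n * κ₁) (spreads : 4 * k * (M * (r + r)) ≤ n * κ₂) where

      open Weights y n few₁ few₂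
      open Deletion n u volume sparse thin

      -- At most `M` points are alive and the slack is at most `M * (r + r)`, so `kills` and
      -- `spreads` bound each quotient by `n/(4k)`. This is the limit of `n/(2k)` productive
      -- choices.
      potential-[] : 4 * k * potential [] ≤ 2 * n
      potential-[] = begin
        4 * k * (aliveCount [] / κ₁ + slack [] / κ₂)
          ≡⟨ *-distribˡ-+ (4 * k) _ _ ⟩
        4 * k * (aliveCount [] / κ₁) + 4 * k * (slack [] / κ₂)
          ≤⟨ +-mono-≤ (quotient κ₁ (aliveCount []) (≤-trans (*-monoʳ-≤ (4 * k) alive≤) kills))
                      (quotient κ₂ (slack []) (≤-trans (*-monoʳ-≤ (4 * k) slack≤) spreads)) ⟩
        n + n
          ≡⟨ cong (n +_) (+-identityʳ n) ⟨
        2 * n ∎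
        where
        open ≤-Reasoning
        quotient : ∀ κ .{{_ : NonZero κ}} x → 4 * k * x ≤ n * κ → 4 * k * (x / κ) ≤ n
        quotient κ x le = *-cancelʳ-≤ _ _ κ (≤-trans (≤-reflexive (*-assoc (4 * k) (x / κ) κ))
          (≤-trans (*-monoʳ-≤ (4 * k) (m/n*n≤m x κ)) le))
        alive≤ : aliveCount [] ≤ M
        alive≤ = ≤-trans (∑-mono pts λ q → 𝟙≤1 (alive? [] q)) (≤-reflexive (trans (∑-const pts 1) (*-identityʳ M)))
        slack≤ : slack [] ≤ M * (r + r)
        slack≤ = ≤-trans (∑-mono pts λ q → m∸n≤m (r + r) (touched [] q)) (≤-reflexive (∑-const pts (r + r)))

      mean : ℕ
      mean = 3 ^ n * y ^ potential []

      instance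
        mean≢0 : NonZero mean
        mean≢0 = m*n≢0 (3 ^ n) (y ^ potential []) {{m^n≢0 3 n}} {{m^n≢0 y (potential [])}}
        M^n≢0 : NonZero (M ^ n)
        M^n≢0 = m^n≢0 M n

      -- The factors normalise both summands to an average of at most `n * mean`. A single sequence
      -- then keeps each of them below `2 * n * mean`; the `suc` supplies the strict inequality for
      -- `∑-average`.
      sum-bound : ∑[ v ← vectors pts n ] (4 * badCount v * mean + n * totalWeight v) < length (vectors pts n) * suc (2 * n * mean)
      sum-bound = begin-strict
        ∑[ v ← V ] (4 * badCount v * mean + n * totalWeight v)
          ≡⟨ trans (∑-+ V _ _) (cong₂ _+_ (trans (∑-*ʳ V mean _) (cong (_* mean) (∑-*ˡ V 4 badCount))) (∑-*ˡ V n totalWeight)) ⟩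
        4 * ∑ V badCount * mean + n * ∑ V totalWeight
          ≤⟨ +-mono-≤ (*-monoˡ-≤ mean (badCount-sum n ≤-refl)) (*-monoʳ-≤ n (totalWeight-sum n ≤-refl)) ⟩
        n * M ^ n * mean + n * ((3 * M) ^ n * y ^ potential [])
          ≡⟨ cong (λ z → n * M ^ n * mean + n * (z * y ^ potential [])) (^-distribʳ-* n 3 M) ⟩
        n * M ^ n * mean + n * (3 ^ n * M ^ n * y ^ potential [])
          ≡⟨ collect n (M ^ n) (3 ^ n) (y ^ potential []) ⟩
        M ^ n * (2 * n * mean)
          <⟨ *-monoʳ-< (M ^ n) (n<1+n (2 * n * mean)) ⟩
        M ^ n * suc (2 * n * mean)
          ≡⟨ cong (_* suc (2 * n * mean)) (length-vectors pts n) ⟨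
        length V * suc (2 * n * mean) ∎
        where
        open ≤-Reasoning
        V = vectors pts n
        collect : ∀ n P t b → n * P * (t * b) + n * (t * P * b) ≡ P * (2 * n * (t * b))
        collect = solve-∀

      sparseSequence : ∃ λ (v : Vec Q n) → 2 * badCount v ≤ n × (∀ S → TripleFree S v → k * ∣ S ∣ ≤ n)
      sparseSequence with ∑-average (vectors pts n) _ _ sum-bound
      ... | v , s≤s le = v , fewBad , small
        where
        open ≤-Reasoning
        fewBad : 2 * badCount v ≤ n
        fewBad = *-cancelˡ-≤ 2 (*-cancelʳ-≤ _ _ mean (begin
          2 * (2 * badCount v) * mean  ≡⟨ cong (_* mean) (*-assoc 2 2 (badCount v)) ⟨
          4 * badCount v * mean        ≤⟨ m+n≤o⇒m≤o _ le ⟩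
          2 * n * mean ∎))
        light : totalWeight v ≤ 2 * mean
        light = *-cancelˡ-≤ n (begin
          n * totalWeight v  ≤⟨ m+n≤o⇒n≤o (4 * badCount v * mean) le ⟩
          2 * n * mean          ≡⟨ rearrange n mean ⟩
          n * (2 * mean) ∎)
          where
          rearrange : ∀ n mean → 2 * n * mean ≡ n * (2 * mean)
          rearrange = solve-∀
        small : ∀ S → TripleFree S v → k * ∣ S ∣ ≤ n
        -- Compare exponents of 3. The left side has `4 * k * ∣ S ∣`; on the right, 1 covers the
        -- factor 2, `n` comes from `3 ^ n`, and `2 * n` from the initial potential, together at
        -- most `4 * n`.
        small S tf = *-cancelˡ-≤ 4 (≮⇒≥ λ lt → <⇒≱ (^-monoʳ-< 3 (s≤s (s≤s z≤n)) lt) (begin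
          3 ^ (4 * (k * ∣ S ∣))             ≡⟨ cong (3 ^_) (*-assoc 4 k ∣ S ∣) ⟨
          3 ^ (4 * k * ∣ S ∣)               ≡⟨ ^-*-assoc 3 (4 * k) ∣ S ∣ ⟨
          y ^ ∣ S ∣                         ≤⟨ tripleFree-weight v S tf ⟩
          totalWeight v                     ≤⟨ light ⟩
          2 * (3 ^ n * y ^ potential [])
            ≤⟨ *-mono-≤ {2} {3} (s≤s (s≤s z≤n)) (*-monoʳ-≤ (3 ^ n) (≤-trans (≤-reflexive (^-*-assoc 3 (4 * k) (potential [])))
                 (^-monoʳ-≤ 3 potential-[]))) ⟩
          3 * (3 ^ n * 3 ^ (2 * n))         ≡⟨ cong (3 *_) (^-distribˡ-+-* 3 n (2 * n)) ⟨
          3 ^ (1 + (n + 2 * n))             ≤⟨ ^-monoʳ-≤ 3 (+-monoˡ-≤ (n + 2 * n) (>-nonZero⁻¹ n)) ⟩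
          3 ^ (n + (n + 2 * n))             ≡⟨ cong (3 ^_) (four n) ⟩
          3 ^ (4 * n) ∎))
          where
          four : ∀ n → n + (n + 2 * n) ≡ 4 * n
          four = solve-∀

-- Configurations in the grid

module Extraction {D m : ℕ} (LS : LineSystem D m) where
  open Sequences LS

  Clean : ∀ {n} → Vec Q n → Set
  Clean []      = ⊤
  Clean (q ∷ v) = ¬ Bad (toList v) q × Clean v

  -- `kept⊆` and `hits≤` guarantee that a term that is not bad in `v` remains so among the kept
  -- terms. `lift` transfers the bound on triple-free subsequences.
  record Thinning {n} (v : Vec Q n) : Set where
    field
      {size}  : ℕ
      kept    : Vec Q size
      clean   : Clean kept
      size≤   : size ≤ n
      size≥   : n ≤ size + badCount v
      kept⊆   : ∀ {q} → q ∈ₗ toList kept → q ∈ₗ toList v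
      hits≤   : ∀ i q → hits (toList kept) i q ≤ hits (toList v) i q
      lift    : ∀ S → TripleFree S kept → ∃ λ T → TripleFree T v × select T v ≡ select S kept

  thin : ∀ {n} (v : Vec Q n) → Thinning v
  thin [] = record
    { kept = [] ; clean = tt ; size≤ = z≤n ; size≥ = z≤n ; kept⊆ = id ; hits≤ = λ _ _ → z≤n
    ; lift = λ { [] _ → [] , tt , refl } }
  thin (q ∷ v) with thin v | bad? (toList v) q
  ... | t | yes bad = record
    { kept = kept ; clean = clean ; size≤ = m≤n⇒m≤1+n size≤
    ; size≥ = ≤-trans (s≤s size≥) (≤-reflexive (trans (sym (+-suc size _))
        (cong (λ z → size + (z + badCount v)) (sym (𝟙-true (bad? (toList v) q) bad)))))
    ; kept⊆ = there ∘ kept⊆ ; hits≤ = λ i p → ≤-trans (hits≤ i p) (m≤n+m _ _)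
    ; lift = λ S tf → let T , tf′ , eq = lift S tf in false ∷ T , tf′ , eq }
    where open Thinning t
  ... | t | no ¬bad = record
    { kept = q ∷ kept
    ; clean = (λ { (inj₁ q∈) → ¬bad (inj₁ (kept⊆ q∈)) ; (inj₂ (i , h)) → ¬bad (inj₂ (i , ≤-trans h (hits≤ i q))) }) , clean
    ; size≤ = s≤s size≤ ; size≥ = s≤s (≤-trans size≥ (+-monoʳ-≤ size (m≤n+m _ _)))
    ; kept⊆ = λ { (here eq) → here eq ; (there p) → there (kept⊆ p) }
    ; hits≤ = λ i p → +-monoʳ-≤ _ (hits≤ i p)
    ; lift = λ { (false ∷ S) tf → let T , tf′ , eq = lift S tf in false ∷ T , tf′ , eq
               ; (true ∷ S) (al , tf) → let T , tf′ , eq = lift S tf in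
                   true ∷ T , (subst (λ σ → Alive σ q) (sym eq) al , tf′) , cong (q ∷_) eq } }
    where open Thinning t

  lookup∈ : ∀ {n} (v : Vec Q n) a → lookup v a ∈ₗ toList v
  lookup∈ (q ∷ v) zero    = here refl
  lookup∈ (q ∷ v) (suc a) = there (lookup∈ v a)

  module _ {i : Fin D} {q : Q} where

    private
      count-head : ∀ {p} → p ~[ i ] q → 𝟙 (sim? p i q) ≡ 1
      count-head = 𝟙-true (sim? _ i q)

    hits≥1 : ∀ {n} (v : Vec Q n) a → lookup v a ~[ i ] q → 1 ≤ hits (toList v) i q
    hits≥1 (p ∷ v) zero    s = ≤-trans (≤-reflexive (sym (count-head s))) (m≤m+n _ _)
    hits≥1 (p ∷ v) (suc a) s = ≤-trans (hits≥1 v a s) (m≤n+m _ _)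

    hits≥2 : ∀ {n} (v : Vec Q n) a b → a ≢ b → lookup v a ~[ i ] q → lookup v b ~[ i ] q → 2 ≤ hits (toList v) i q
    hits≥2 (p ∷ v) zero    zero    a≢b s t = contradiction refl a≢b
    hits≥2 (p ∷ v) zero    (suc b) a≢b s t = +-mono-≤ (≤-reflexive (sym (count-head s))) (hits≥1 v b t)
    hits≥2 (p ∷ v) (suc a) zero    a≢b s t = +-mono-≤ (≤-reflexive (sym (count-head t))) (hits≥1 v a s)
    hits≥2 (p ∷ v) (suc a) (suc b) a≢b s t = ≤-trans (hits≥2 v a b (a≢b ∘ cong suc) s t) (m≤n+m _ _)

    hits≥3 : ∀ {n} (v : Vec Q n) a b c → a ≢ b → a ≢ c → b ≢ c →
             lookup v a ~[ i ] q → lookup v b ~[ i ] q → lookup v c ~[ i ] q → 3 ≤ hits (toList v) i q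
    hits≥3 (p ∷ v) zero zero c ab ac bc s t u = contradiction refl ab
    hits≥3 (p ∷ v) zero (suc b) zero ab ac bc s t u = contradiction refl ac
    hits≥3 (p ∷ v) (suc a) zero zero ab ac bc s t u = contradiction refl bc
    hits≥3 (p ∷ v) zero (suc b) (suc c) ab ac bc s t u = +-mono-≤ (≤-reflexive (sym (count-head s))) (hits≥2 v b c (bc ∘ cong suc) t u)
    hits≥3 (p ∷ v) (suc a) zero (suc c) ab ac bc s t u = +-mono-≤ (≤-reflexive (sym (count-head t))) (hits≥2 v a c (ac ∘ cong suc) s u)
    hits≥3 (p ∷ v) (suc a) (suc b) zero ab ac bc s t u = +-mono-≤ (≤-reflexive (sym (count-head u))) (hits≥2 v a b (ab ∘ cong suc) s t)
    hits≥3 (p ∷ v) (suc a) (suc b) (suc c) ab ac bc s t u =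
      ≤-trans (hits≥3 v a b c (ab ∘ cong suc) (ac ∘ cong suc) (bc ∘ cong suc) s t u) (m≤n+m _ _)

    select-hits≥1 : ∀ {n} (S : Subset n) (v : Vec Q n) → 1 ≤ hits (select S v) i q → ∃ λ a → a ∈ S × lookup v a ~[ i ] q
    select-hits≥1 [] [] ()
    select-hits≥1 (false ∷ S) (p ∷ v) h = let a , a∈S , s = select-hits≥1 S v h in suc a , there a∈S , s
    select-hits≥1 (true ∷ S)  (p ∷ v) h with sim? p i q
    ... | yes s = zero , here , s
    ... | no _  = let a , a∈S , s = select-hits≥1 S v h in suc a , there a∈S , s

    select-hits≥2 : ∀ {n} (S : Subset n) (v : Vec Q n) → 2 ≤ hits (select S v) i q →
                    ∃ λ a → ∃ λ b → a ≢ b × (a ∈ S × lookup v a ~[ i ] q) × (b ∈ S × lookup v b ~[ i ] q)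
    select-hits≥2 [] [] ()
    select-hits≥2 (false ∷ S) (p ∷ v) h = let a , b , ne , (a∈ , s) , (b∈ , t) = select-hits≥2 S v h in
      suc a , suc b , ne ∘ suc-injective , (there a∈ , s) , (there b∈ , t)
    select-hits≥2 (true ∷ S)  (p ∷ v) h with sim? p i q
    ... | yes s = let b , b∈ , t = select-hits≥1 S v (≤-pred h) in zero , suc b , (λ ()) , (here , s) , (there b∈ , t)
    ... | no _  = let a , b , ne , (a∈ , s) , (b∈ , t) = select-hits≥2 S v h in
      suc a , suc b , ne ∘ suc-injective , (there a∈ , s) , (there b∈ , t)

  lookup-injective : ∀ {n} (v : Vec Q n) → Clean v → Injective _≡_ _≡_ (lookup v)
  lookup-injective (q ∷ v) (ok , cl) {zero}  {zero}  eq = refl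
  lookup-injective (q ∷ v) (ok , cl) {zero}  {suc b} eq = contradiction (inj₁ (subst (_∈ₗ toList v) (sym eq) (lookup∈ v b))) ok
  lookup-injective (q ∷ v) (ok , cl) {suc a} {zero}  eq = contradiction (inj₁ (subst (_∈ₗ toList v) eq (lookup∈ v a))) ok
  lookup-injective (q ∷ v) (ok , cl) {suc a} {suc b} eq = cong suc (lookup-injective v cl eq)

  -- The foremost of the four positions holds the newest term, and the other three on its line would
  -- make it `Bad`. The last clauses exclude coinciding positions.
  clean-noFour : ∀ {n} (v : Vec Q n) → Clean v → ∀ i a b c e → a ≢ b → a ≢ c → a ≢ e → b ≢ c → b ≢ e → c ≢ e →
    let _~_ = λ s t → lookup v s ~[ i ] lookup v t in ¬ (a ~ b × a ~ c × a ~ e)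
  clean-noFour (q ∷ v) (ok , cl) i zero (suc b) (suc c) (suc e) ab ac ae bc be ce (r , s , t) =
    ok (inj₂ (i , hits≥3 v b c e (bc ∘ cong suc) (be ∘ cong suc) (ce ∘ cong suc) (~-sym r) (~-sym s) (~-sym t)))
  clean-noFour (q ∷ v) (ok , cl) i (suc a) zero (suc c) (suc e) ab ac ae bc be ce (r , s , t) =
    ok (inj₂ (i , hits≥3 v a c e (ac ∘ cong suc) (ae ∘ cong suc) (ce ∘ cong suc) r (~-trans (~-sym s) r) (~-trans (~-sym t) r)))
  clean-noFour (q ∷ v) (ok , cl) i (suc a) (suc b) zero (suc e) ab ac ae bc be ce (r , s , t) =
    ok (inj₂ (i , hits≥3 v a b e (ab ∘ cong suc) (ae ∘ cong suc) (be ∘ cong suc) s (~-trans (~-sym r) s) (~-trans (~-sym t) s)))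
  clean-noFour (q ∷ v) (ok , cl) i (suc a) (suc b) (suc c) zero ab ac ae bc be ce (r , s , t) =
    ok (inj₂ (i , hits≥3 v a b c (ab ∘ cong suc) (ac ∘ cong suc) (bc ∘ cong suc) t (~-trans (~-sym r) t) (~-trans (~-sym s) t)))
  clean-noFour (q ∷ v) (ok , cl) i (suc a) (suc b) (suc c) (suc e) ab ac ae bc be ce h =
    clean-noFour v cl i a b c e (ab ∘ cong suc) (ac ∘ cong suc) (ae ∘ cong suc) (bc ∘ cong suc) (be ∘ cong suc) (ce ∘ cong suc) h
  clean-noFour v cl i zero zero c e ab ac ae bc be ce _ = contradiction refl ab
  clean-noFour v cl i zero (suc b) zero e ab ac ae bc be ce _ = contradiction refl ac
  clean-noFour v cl i zero (suc b) (suc c) zero ab ac ae bc be ce _ = contradiction refl ae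
  clean-noFour v cl i (suc a) zero zero e ab ac ae bc be ce _ = contradiction refl bc
  clean-noFour v cl i (suc a) zero (suc c) zero ab ac ae bc be ce _ = contradiction refl be
  clean-noFour v cl i (suc a) (suc b) zero zero ab ac ae bc be ce _ = contradiction refl ce

  Unaligned : ∀ {n} → (Fin n → Q) → Subset n → Set
  Unaligned c S = ∀ i a b e → a ∈ S → b ∈ S → e ∈ S → a ≢ b → a ≢ e → b ≢ e →
                  ¬ (c a ~[ i ] c e × c b ~[ i ] c e)

  -- Two hits at a selected head come from two selected positions behind it, which together with the
  -- head form an aligned triple.
  unaligned⇒tripleFree : ∀ {n} (S : Subset n) (v : Vec Q n) → Unaligned (lookup v) S → TripleFree S v
  unaligned⇒tripleFree []          []      un = tt
  unaligned⇒tripleFree (false ∷ S) (q ∷ v) un = unaligned⇒tripleFree S v λ i a b e a∈ b∈ e∈ ab ae be →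
    un i (suc a) (suc b) (suc e) (there a∈) (there b∈) (there e∈) (ab ∘ suc-injective) (ae ∘ suc-injective) (be ∘ suc-injective)
  unaligned⇒tripleFree (true ∷ S)  (q ∷ v) un = alive , unaligned⇒tripleFree S v λ i a b e a∈ b∈ e∈ ab ae be →
    un i (suc a) (suc b) (suc e) (there a∈) (there b∈) (there e∈) (ab ∘ suc-injective) (ae ∘ suc-injective) (be ∘ suc-injective)
    where
    alive : Alive (select S v) q
    alive i = ≮⇒≥ λ h → let a , b , ab , (a∈ , s) , (b∈ , t) = select-hits≥2 S v h in
      un i (suc a) (suc b) zero (there a∈) (there b∈) here (ab ∘ suc-injective) (λ ()) (λ ()) (s , t)

-- Here `n` is the length of the original sequence, of which at least half survives; `small`
-- therefore bounds `S` by a proportion `2/k` of the points.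
record Configuration {D m : ℕ} (LS : LineSystem D m) (k n : ℕ) : Set where
  open LineSystem LS
  open Extraction LS using (Unaligned)
  field
    size      : ℕ
    size≤     : size ≤ n
    size≥     : n ≤ 2 * size
    point     : Fin size → Q
    injective : Injective _≡_ _≡_ point
    noFour    : ∀ i a b c e → a ≢ b → a ≢ c → a ≢ e → b ≢ c → b ≢ e → c ≢ e →
                ¬ (point a ~[ i ] point b × point a ~[ i ] point c × point a ~[ i ] point e)
    small     : ∀ S → Unaligned point S → k * ∣ S ∣ ≤ n

module _ {D m : ℕ} (LS : LineSystem D m) where
  open Sequences LS
  open Extraction LS

  configuration : ∀ {k n} → (∃ λ (v : Vec Q n) → 2 * badCount v ≤ n × (∀ S → TripleFree S v → k * ∣ S ∣ ≤ n)) →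
                  Configuration LS k n
  configuration {k} {n} (v , few , sparse) = record
    { size = size ; size≤ = size≤ ; size≥ = +-cancelʳ-≤ n n (2 * size) (begin
        n + n                   ≤⟨ +-mono-≤ size≥ size≥ ⟩
        (size + badCount v) + (size + badCount v) ≡⟨ double size (badCount v) ⟩
        2 * size + 2 * badCount v ≤⟨ +-monoʳ-≤ (2 * size) few ⟩
        2 * size + n ∎)
    ; point = lookup kept ; injective = lookup-injective kept clean ; noFour = clean-noFour kept clean
    ; small = λ S un → let T , tf , eq = lift S (unaligned⇒tripleFree S kept un) in begin
        k * ∣ S ∣                       ≡⟨ cong (k *_) (length-select S kept) ⟨
        k * length (select S kept)      ≡⟨ cong (λ σ → k * length σ) eq ⟨
        k * length (select T v)         ≡⟨ cong (k *_) (length-select T v) ⟩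
        k * ∣ T ∣                       ≤⟨ sparse T tf ⟩
        n ∎ }
    where
    open ≤-Reasoning
    open Thinning (thin v)
    double : ∀ a b → (a + b) + (a + b) ≡ 2 * a + 2 * b
    double = solve-∀

∑-𝟙-one : ∀ {A : Set} {L : List A} (_≟_ : (x y : A) → Dec (x ≡ y)) → Unique L → ∀ {y} → y ∈ₗ L → ∑[ x ← L ] 𝟙 (x ≟ y) ≡ 1
∑-𝟙-one _≟_ uniq {y} y∈L = ≤-antisym (∑-𝟙-unique (_≟ y) uniq λ a b → trans a (sym b))
  (≤-trans (≤-reflexive (sym (𝟙-true (y ≟ y) refl))) (term≤∑ (λ x → 𝟙 (x ≟ y)) y∈L))

-- The grid as a line system

module Grid (m : ℕ) where

  Point : ℕ → Set
  Point D = Vec (Fin m) D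

  points : ∀ D → List (Point D)
  points = vectors (allFin m)

  points-unique : ∀ D → Unique (points D)
  points-unique zero    = All.[] ∷ []
  points-unique (suc D) = cartesianProductWith⁺ _ (λ eq → let x≡y , v≡w = ∷-injective eq in v≡w , x≡y) (points-unique D) (allFin⁺ m)

  _≟P_ : ∀ {D} (p q : Point D) → Dec (p ≡ q)
  _≟P_ = ≡-dec _≟F_

  Parallel : ∀ {D} → Point D → Fin D → Point D → Set
  Parallel p i q = ∀ j → j ≢ i → lookup p j ≡ lookup q j

  parallel? : ∀ {D} (p : Point D) i q → Dec (Parallel p i q)
  parallel? p i q = all? λ j → ¬? (j ≟F i) →-dec (lookup p j ≟F lookup q j)

  lookup-ext : ∀ {D} (p q : Point D) → (∀ j → lookup p j ≡ lookup q j) → p ≡ q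
  lookup-ext []      []      h = refl
  lookup-ext (x ∷ p) (y ∷ q) h = cong₂ _∷_ (h zero) (lookup-ext p q (h ∘ suc))

  parallel-meet : ∀ {D} {p q : Point D} {i j} → p ≢ q → Parallel p i q → Parallel p j q → i ≡ j
  parallel-meet {p = p} {q} {i} {j} p≢q s t with i ≟F j
  ... | yes i≡j = i≡j
  ... | no i≢j  = contradiction (lookup-ext p q agree) p≢q
    where
    agree : ∀ l → lookup p l ≡ lookup q l
    agree l with l ≟F i
    ... | yes refl = t l i≢j
    ... | no l≢i   = s l l≢i

  -- In direction `zero` the head is free and the tail is forced. In the other directions the head
  -- is forced and the tail is counted by induction.
  parallel-size : ∀ {D} i (q : Point D) → ∑[ p ← points D ] 𝟙 (parallel? p i q) ≡ m
  parallel-size {suc D} zero (y ∷ q) = begin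
    ∑[ p ← points (suc D) ] 𝟙 (parallel? p zero (y ∷ q))
      ≡⟨ ∑-vectors (allFin m) D _ ⟩
    ∑[ p ← points D ] ∑[ x ← allFin m ] 𝟙 (parallel? (x ∷ p) zero (y ∷ q))
      ≡⟨ ∑-cong (points D) (λ p → ∑-cong (allFin m) λ x → 𝟙-cong (parallel? (x ∷ p) zero (y ∷ q)) (p ≟P q)
           (λ s → lookup-ext p q λ j → s (suc j) λ ())
           (λ { eq zero ne → contradiction refl ne ; eq (suc j) _ → cong (λ v → lookup v j) eq })) ⟩
    ∑[ p ← points D ] ∑[ x ← allFin m ] 𝟙 (p ≟P q)
      ≡⟨ trans (∑-cong (points D) λ p → ∑-allFin-const m _) (∑-*ˡ (points D) m _) ⟩
    m * ∑[ p ← points D ] 𝟙 (p ≟P q)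
      ≡⟨ cong (m *_) (∑-𝟙-one _≟P_ (points-unique D) (∈-vectors (allFin m) ∈-allFin q)) ⟩
    m * 1
      ≡⟨ *-identityʳ m ⟩
    m ∎
    where open ≡-Reasoning
  parallel-size {suc D} (suc i) (y ∷ q) = begin
    ∑[ p ← points (suc D) ] 𝟙 (parallel? p (suc i) (y ∷ q))
      ≡⟨ ∑-vectors (allFin m) D _ ⟩
    ∑[ p ← points D ] ∑[ x ← allFin m ] 𝟙 (parallel? (x ∷ p) (suc i) (y ∷ q))
      ≡⟨ ∑-cong (points D) (λ p → ∑-cong (allFin m) λ x → trans
           (𝟙-cong (parallel? (x ∷ p) (suc i) (y ∷ q)) (parallel? p i q ×-dec (x ≟F y))
             (λ s → (λ j ne → s (suc j) (ne ∘ suc-injective)) , s zero λ ())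
             (λ { (s , eq) zero _ → eq ; (s , eq) (suc j) ne → s j (ne ∘ cong suc) }))
           (𝟙-× (parallel? p i q) (x ≟F y))) ⟩
    ∑[ p ← points D ] ∑[ x ← allFin m ] (𝟙 (parallel? p i q) * 𝟙 (x ≟F y))
      ≡⟨ ∑-cong (points D) (λ p → trans (∑-*ˡ (allFin m) (𝟙 (parallel? p i q)) _)
           (trans (cong (𝟙 (parallel? p i q) *_) (∑-𝟙-one _≟F_ (allFin⁺ m) (∈-allFin y))) (*-identityʳ _))) ⟩
    ∑[ p ← points D ] 𝟙 (parallel? p i q)
      ≡⟨ parallel-size i q ⟩
    m ∎
    where
    open ≡-Reasoning

  grid : ∀ D → LineSystem D m
  grid D = record
    { Q = Point D ; _≟Q_ = _≟P_ ; pts = points D ; unique = points-unique D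
    ; _~[_]_ = Parallel ; sim? = parallel?
    ; ~-sym = λ s j ne → sym (s j ne)
    ; ~-trans = λ s t j ne → trans (s j ne) (t j ne)
    ; ~-meet = parallel-meet
    ; line-size = parallel-size }

  length-points : ∀ D → length (points D) ≡ m ^ D
  length-points D = trans (length-vectors (allFin m) D) (cong (_^ D) (length-tabulate {n = m} id))

n<2^n : ∀ n → n < 2 ^ n
n<2^n zero    = s≤s z≤n
n<2^n (suc n) = ≤-trans (s≤s (n<2^n n)) (+-mono-≤ (m^n>0 2 n) (≤-reflexive (sym (+-identityʳ _))))

-- Choice of the parameters

module Parameters (k : ℕ) .{{_ : NonZero k}} where

  -- With u = y ^ 14, r = y ^ 22, w₁ = y ^ 2, w₂ = y ^ 7, the exponents satisfy 1 + d + w₁ < u + m + r, 1 + w₂ < m,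
  -- d < 3u, u + m < r + w₁ and u + m + r < d + w₂ (names standing for their exponents), each with room for the constants.
  y d D m e n : ℕ
  y = 3 ^ (4 * k)
  d = y ^ 41
  D = d + d
  m = y ^ 9
  -- The exponent of `u * m` is `23 = 14 + 9`, so that `volume` holds with equality.
  e = 9 * D ∸ 23
  n = y ^ e

  1≤k : 1 ≤ k
  1≤k = >-nonZero⁻¹ k

  81≤y : 81 ≤ y
  81≤y = ^-monoʳ-≤ 3 (*-monoʳ-≤ 4 1≤k)

  y≢0 : NonZero y
  y≢0 = >-nonZero (≤-trans (s≤s z≤n) 81≤y)

  private instance
    _ = y≢0

  8k<y : 8 * k < y
  8k<y = begin-strict
    8 * k            ≤⟨ *-monoʳ-≤ 8 (<⇒≤ (n<2^n k)) ⟩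
    2 ^ 3 * 2 ^ k    ≡⟨ ^-distribˡ-+-* 2 3 k ⟨
    2 ^ (3 + k)      ≤⟨ ^-monoʳ-≤ 2 (+-monoˡ-≤ k (*-monoʳ-≤ 3 1≤k)) ⟩
    2 ^ (3 * k + k)  ≡⟨ cong (2 ^_) (+-comm (3 * k) k) ⟩
    2 ^ (4 * k)      <⟨ ^-monoˡ-< (4 * k) {{m*n≢0 4 k}} (s≤s (s≤s (s≤s z≤n))) ⟩
    3 ^ (4 * k)      ∎
    where open ≤-Reasoning

  literal≤y : ∀ c → c ≤ 81 → c ≤ y
  literal≤y c c≤ = ≤-trans c≤ 81≤y

  23≤9D : 23 ≤ 9 * D
  23≤9D = begin
    23         ≤⟨ m≤m+n 23 58 ⟩
    81         ≤⟨ 81≤y ⟩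
    y          ≤⟨ m≤m*n y (y ^ 40) {{m^n≢0 y 40}} ⟩
    d          ≤⟨ m≤m+n d d ⟩
    D          ≤⟨ m≤n*m D 9 ⟩
    9 * D ∎
    where open ≤-Reasoning

  open Grid m using (grid; length-points)
  open Sequences (grid D) using (M; module Potential)
  open Potential d (y ^ 22) (y ^ 2) (y ^ 7) refl using (κ₁; κ₂)

  M≡y^9D : M ≡ y ^ (9 * D)
  M≡y^9D = trans (length-points D) (^-*-assoc y 9 D)

  M≡ : M ≡ n * y ^ 23
  M≡ = begin
    M              ≡⟨ M≡y^9D ⟩
    y ^ (9 * D)    ≡⟨ cong (y ^_) (m∸n+n≡m 23≤9D) ⟨
    y ^ (e + 23)   ≡⟨ ^-distribˡ-+-* y e 23 ⟩
    n * y ^ 23 ∎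
    where open ≡-Reasoning

  open ≤-Reasoning

  few₁ : (y + y) * (n * (D * y ^ 2)) ≤ M * y ^ 22
  few₁ = begin
    (y + y) * (n * ((d + d) * y ^ 2))   ≡⟨ collect y n d (y ^ 2) ⟩
    n * (4 * (y * (d * y ^ 2)))         ≡⟨ cong (λ z → n * (4 * (y * z))) (^-distribˡ-+-* y 41 2) ⟨
    n * (4 * y ^ 44)                    ≤⟨ *-monoʳ-≤ n (*-monoˡ-≤ (y ^ 44) (literal≤y 4 (m≤m+n 4 77))) ⟩
    n * y ^ 45                          ≡⟨ cong (n *_) (^-distribˡ-+-* y 23 22) ⟩
    n * (y ^ 23 * y ^ 22)               ≡⟨ *-assoc n (y ^ 23) (y ^ 22) ⟨
    n * y ^ 23 * y ^ 22                 ≡⟨ cong (_* y ^ 22) M≡ ⟨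
    M * y ^ 22 ∎
    where
    collect : ∀ y n d w → (y + y) * (n * ((d + d) * w)) ≡ n * (4 * (y * (d * w)))
    collect = solve-∀

  few₂ : (y + y) * (y ^ 7 + y ^ 7) ≤ y ^ 9
  few₂ = begin
    (y + y) * (y ^ 7 + y ^ 7)  ≡⟨ collect y (y ^ 7) ⟩
    4 * y ^ 8                  ≤⟨ *-monoˡ-≤ (y ^ 8) (literal≤y 4 (m≤m+n 4 77)) ⟩
    y ^ 9 ∎
    where
    collect : ∀ y a → (y + y) * (a + a) ≡ 4 * (y * a)
    collect = solve-∀

  volume : n * (y ^ 14 * y ^ 9) ≤ M
  volume = ≤-reflexive (trans (cong (n *_) (sym (^-distribˡ-+-* y 14 9))) (sym M≡))

  sparse : 8 * D ≤ (y ^ 14) ^ 3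
  sparse = begin
    8 * (d + d)      ≡⟨ collect d ⟩
    16 * y ^ 41      ≤⟨ *-monoˡ-≤ (y ^ 41) (literal≤y 16 (m≤m+n 16 65)) ⟩
    y ^ 42           ≡⟨ ^-*-assoc y 14 3 ⟨
    (y ^ 14) ^ 3 ∎
    where
    collect : ∀ d → 8 * (d + d) ≡ 16 * d
    collect = solve-∀

  thin : 8 * n ≤ M
  thin = begin
    8 * n       ≡⟨ *-comm 8 n ⟩
    n * 8       ≤⟨ *-monoʳ-≤ n (≤-trans (literal≤y 8 (m≤m+n 8 73)) (m≤m*n y (y ^ 22) {{m^n≢0 y 22}})) ⟩
    n * y ^ 23  ≡⟨ M≡ ⟨
    M ∎

  4ky≤y²∸1 : 4 * k * y ≤ y ^ 2 ∸ 1
  4ky≤y²∸1 = m+n≤o⇒m≤o∸n (4 * k * y) (begin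
    4 * k * y + 1     ≤⟨ +-mono-≤ (*-monoˡ-≤ y (*-monoˡ-≤ k (m≤m+n 4 4))) (literal≤y 1 (m≤m+n 1 80)) ⟩
    8 * k * y + y     ≡⟨ +-comm (8 * k * y) y ⟩
    suc (8 * k) * y   ≤⟨ *-monoˡ-≤ y 8k<y ⟩
    y * y             ≡⟨ cong (y *_) (*-identityʳ y) ⟨
    y ^ 2 ∎)

  kills : 4 * k * M ≤ n * κ₁
  kills = begin
    4 * k * M                    ≡⟨ cong (4 * k *_) M≡ ⟩
    4 * k * (n * (y * y ^ 22))   ≡⟨ shuffle k n y (y ^ 22) ⟩
    n * (y ^ 22 * (4 * k * y))   ≤⟨ *-monoʳ-≤ n (*-monoʳ-≤ (y ^ 22) 4ky≤y²∸1) ⟩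
    n * κ₁ ∎
    where
    shuffle : ∀ k n y a → 4 * k * (n * (y * a)) ≡ n * (a * (4 * k * y))
    shuffle = solve-∀

  y^40≤ : y ^ 40 ≤ d ∸ (y ^ 22 + y ^ 22)
  y^40≤ = m+n≤o⇒m≤o∸n (y ^ 40) (begin
    y ^ 40 + (y ^ 22 + y ^ 22)   ≤⟨ +-monoʳ-≤ (y ^ 40) (+-mono-≤ 22≤40 22≤40) ⟩
    y ^ 40 + (y ^ 40 + y ^ 40)   ≡⟨ triple (y ^ 40) ⟩
    3 * y ^ 40                   ≤⟨ *-monoˡ-≤ (y ^ 40) (literal≤y 3 (m≤m+n 3 78)) ⟩
    y ^ 41 ∎)
    where
    22≤40 : y ^ 22 ≤ y ^ 40
    22≤40 = ^-monoʳ-≤ y (m≤m+n 22 18)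
    triple : ∀ a → a + (a + a) ≡ 3 * a
    triple = solve-∀

  y^6≤ : y ^ 6 ≤ y ^ 7 ∸ 1
  y^6≤ = m+n≤o⇒m≤o∸n (y ^ 6) (begin
    y ^ 6 + 1       ≤⟨ +-monoʳ-≤ (y ^ 6) (m^n>0 y 6) ⟩
    y ^ 6 + y ^ 6   ≡⟨ cong (y ^ 6 +_) (+-identityʳ _) ⟨
    2 * y ^ 6       ≤⟨ *-monoˡ-≤ (y ^ 6) (literal≤y 2 (m≤m+n 2 79)) ⟩
    y ^ 7 ∎)

  spreads : 4 * k * (M * (y ^ 22 + y ^ 22)) ≤ n * κ₂
  spreads = begin
    4 * k * (M * (y ^ 22 + y ^ 22))            ≡⟨ cong (λ z → 4 * k * (z * (y ^ 22 + y ^ 22))) M≡ ⟩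
    4 * k * (n * y ^ 23 * (y ^ 22 + y ^ 22))   ≡⟨ collect k n (y ^ 23) (y ^ 22) ⟩
    n * (8 * k * (y ^ 23 * y ^ 22))            ≡⟨ cong (λ z → n * (8 * k * z)) (^-distribˡ-+-* y 23 22) ⟨
    n * (8 * k * y ^ 45)                       ≤⟨ *-monoʳ-≤ n (*-monoˡ-≤ (y ^ 45) (<⇒≤ 8k<y)) ⟩
    n * y ^ 46                                 ≡⟨ cong (n *_) (^-distribˡ-+-* y 40 6) ⟩
    n * (y ^ 40 * y ^ 6)                       ≤⟨ *-monoʳ-≤ n (*-mono-≤ y^40≤ y^6≤) ⟩
    n * κ₂ ∎
    where
    collect : ∀ k n a b → 4 * k * (n * a * (b + b)) ≡ n * (8 * k * (a * b))
    collect = solve-∀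

  instance
    κ₁≢0 : NonZero κ₁
    κ₁≢0 = m*n≢0 (y ^ 22) (y ^ 2 ∸ 1) {{m^n≢0 y 22}} {{>-nonZero (≤-trans (*-mono-≤ (*-mono-≤ {1} {4} (s≤s z≤n) 1≤k) (literal≤y 1 (m≤m+n 1 80))) 4ky≤y²∸1)}}
    κ₂≢0 : NonZero κ₂
    κ₂≢0 = m*n≢0 (d ∸ (y ^ 22 + y ^ 22)) (y ^ 7 ∸ 1) {{>-nonZero (≤-trans (m^n>0 y 40) y^40≤)}} {{>-nonZero (≤-trans (m^n>0 y 6) y^6≤)}}
    n≢0 : NonZero n
    n≢0 = m^n≢0 y e
    d≢0 : NonZero d
    d≢0 = m^n≢0 y 41
    r≢0 : NonZero (y ^ 22)
    r≢0 = m^n≢0 y 22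
    m≢0 : NonZero m
    m≢0 = m^n≢0 y 9
    M≢0 : NonZero M
    M≢0 = subst NonZero (sym M≡y^9D) (m^n≢0 y (9 * D))
    D≢0 : NonZero D
    D≢0 = >-nonZero (≤-trans (m^n>0 y 41) (m≤m+n d d))

  configuration′ : Configuration (grid D) k n
  configuration′ = configuration (grid D) {k} {n}
    (Existence.sparseSequence (grid D) k d (y ^ 22) (y ^ 2) (y ^ 7) n (y ^ 14) refl
      few₁ few₂ volume sparse thin kills spreads)

  -- Both `y` and `D` are exponential in `k`, so `y ^ (9 * D)` is doubly exponential. The constants
  -- in the upper exponent add up to at most `337 * k`, rounded up generously.
  n≤ : n ≤ 2 ^ 2 ^ (400 * k)
  n≤ = begin
    n                          ≤⟨ m≤m*n n (y ^ 23) {{m^n≢0 y 23}} ⟩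
    n * y ^ 23                 ≡⟨ M≡ ⟨
    M                          ≡⟨ M≡y^9D ⟩
    y ^ (9 * D)                ≤⟨ ^-monoˡ-≤ (9 * D) y≤ ⟩
    (2 ^ (8 * k)) ^ (9 * D)    ≡⟨ ^-*-assoc 2 (8 * k) (9 * D) ⟩
    2 ^ (8 * k * (9 * D))      ≤⟨ ^-monoʳ-≤ 2 exponent ⟩
    2 ^ 2 ^ (400 * k) ∎
    where
    y≤ : y ≤ 2 ^ (8 * k)
    y≤ = begin
      3 ^ (4 * k)        ≤⟨ ^-monoˡ-≤ (4 * k) (m≤m+n 3 1) ⟩
      (2 ^ 2) ^ (4 * k)  ≡⟨ ^-*-assoc 2 2 (4 * k) ⟩
      2 ^ (2 * (4 * k))  ≡⟨ cong (2 ^_) (*-assoc 2 4 k) ⟨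
      2 ^ (8 * k) ∎
    d≤ : d ≤ 2 ^ (328 * k)
    d≤ = begin
      y ^ 41               ≤⟨ ^-monoˡ-≤ 41 y≤ ⟩
      (2 ^ (8 * k)) ^ 41   ≡⟨ ^-*-assoc 2 (8 * k) 41 ⟩
      2 ^ (8 * k * 41)     ≡⟨ cong (2 ^_) (rearrange k) ⟩
      2 ^ (328 * k) ∎
      where
      rearrange : ∀ k → 8 * k * 41 ≡ 328 * k
      rearrange = solve-∀
    exponent : 8 * k * (9 * D) ≤ 2 ^ (400 * k)
    exponent = begin
      8 * k * (9 * (d + d))               ≡⟨ collect k d ⟩
      144 * (k * d)                       ≤⟨ *-mono-≤ (m≤m+n 144 112) (*-mono-≤ (<⇒≤ (n<2^n k)) d≤) ⟩
      2 ^ 8 * (2 ^ k * 2 ^ (328 * k))     ≡⟨ cong (2 ^ 8 *_) (^-distribˡ-+-* 2 k (328 * k)) ⟨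
      2 ^ 8 * 2 ^ (k + 328 * k)           ≡⟨ ^-distribˡ-+-* 2 8 (k + 328 * k) ⟨
      2 ^ (8 + (k + 328 * k))             ≤⟨ ^-monoʳ-≤ 2 (begin
        8 + (k + 328 * k)                   ≤⟨ +-monoˡ-≤ (k + 328 * k) (*-monoʳ-≤ 8 1≤k) ⟩
        8 * k + (k + 328 * k)               ≤⟨ m≤m+n _ (63 * k) ⟩
        8 * k + (k + 328 * k) + 63 * k      ≡⟨ sum k ⟩
        400 * k ∎) ⟩
      2 ^ (400 * k) ∎
      where
      collect : ∀ k d → 8 * k * (9 * (d + d)) ≡ 144 * (k * d)
      collect = solve-∀
      sum : ∀ k → 8 * k + (k + 328 * k) + 63 * k ≡ 400 * k
      sum = solve-∀

abstract
  -- Only the length `n` carries a size bound; `m` and `D` are left free because the projection to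
  -- the plane removes the dimension.
  gridConfiguration : ∀ k → 1 ≤ k → ∃ λ m → ∃ λ D → ∃ λ n →
    1 ≤ n × Configuration (Grid.grid m D) k n × n ≤ 2 ^ 2 ^ (400 * k)
  gridConfiguration k 1≤k = m , D , n , >-nonZero⁻¹ n , configuration′ , n≤
    where open Parameters k {{>-nonZero 1≤k}}

-- Generic projection to the plane

open import Data.Integer using (+_)

-- Natural coefficients keep the projected coordinates in `ℕ`, where equality is decidable.
dot : ∀ {E} → (Fin E → ℕ) → (Fin E → ℤ) → ℤ
dot {zero}  α w = 0ℤ
dot {suc E} α w = + α zero ℤ.* w zero ℤ.+ dot (α ∘ suc) (w ∘ suc)

dot-comb : ∀ {E} (α : Fin E → ℕ) s r (f g : Fin E → ℤ) →
           dot α (λ e → s ℤ.* f e ℤ.- r ℤ.* g e) ≡ s ℤ.* dot α f ℤ.- r ℤ.* dot α g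
dot-comb {zero}  α s r f g = lemma s r
  where lemma : ∀ s r → 0ℤ ≡ s ℤ.* 0ℤ ℤ.- r ℤ.* 0ℤ
        lemma = ℤ-Solver.solve-∀
dot-comb {suc E} α s r f g = trans (cong (ℤ._+_ (+ α zero ℤ.* (s ℤ.* f zero ℤ.- r ℤ.* g zero))) (dot-comb (α ∘ suc) s r (f ∘ suc) (g ∘ suc)))
  (lemma (+ α zero) s r (f zero) (g zero) (dot (α ∘ suc) (f ∘ suc)) (dot (α ∘ suc) (g ∘ suc)))
  where lemma : ∀ a s r x y F G → a ℤ.* (s ℤ.* x ℤ.- r ℤ.* y) ℤ.+ (s ℤ.* F ℤ.- r ℤ.* G)
                ≡ s ℤ.* (a ℤ.* x ℤ.+ F) ℤ.- r ℤ.* (a ℤ.* y ℤ.+ G)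
        lemma = ℤ-Solver.solve-∀

dot-scale : ∀ {E} K (α : Fin E → ℕ) w → dot (λ e → K * α e) w ≡ + K ℤ.* dot α w
dot-scale {zero}  K α w = sym (ℤ.*-zeroʳ (+ K))
dot-scale {suc E} K α w = trans
  (cong₂ ℤ._+_ (cong (ℤ._* w zero) (ℤ.pos-* K (α zero))) (dot-scale K (α ∘ suc) (w ∘ suc)))
  (lemma (+ K) (+ α zero) (w zero) (dot (α ∘ suc) (w ∘ suc)))
  where lemma : ∀ K a w F → K ℤ.* a ℤ.* w ℤ.+ K ℤ.* F ≡ K ℤ.* (a ℤ.* w ℤ.+ F)
        lemma = ℤ-Solver.solve-∀

dot-zero : ∀ {E} (α : Fin E → ℕ) {w} → (∀ e → w e ≡ 0ℤ) → dot α w ≡ 0ℤ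
dot-zero {zero}  α w≡0 = refl
dot-zero {suc E} α w≡0 = cong₂ ℤ._+_ (trans (cong (+ α zero ℤ.*_) (w≡0 zero)) (ℤ.*-zeroʳ (+ α zero)))
                                    (dot-zero (α ∘ suc) (w≡0 ∘ suc))

dot-cong : ∀ {E} (α : Fin E → ℕ) {v w} → (∀ e → v e ≡ w e) → dot α v ≡ dot α w
dot-cong {zero}  α v≡w = refl
dot-cong {suc E} α v≡w = cong₂ ℤ._+_ (cong (+ α zero ℤ.*_) (v≡w zero)) (dot-cong (α ∘ suc) (v≡w ∘ suc))

-- The weights of the tail are multiplied by a `K` exceeding every leading entry. A nonzero tail
-- product then cannot be cancelled by the leading entry, and a zero one forces that entry to vanish
-- too.
separating : ∀ {E} (W : List (Fin E → ℤ)) →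
             ∃ λ (α : Fin E → ℕ) → ∀ {w} → w ∈ₗ W → dot α w ≡ 0ℤ → ∀ e → w e ≡ 0ℤ
separating {zero}  W = (λ ()) , λ _ _ ()
separating {suc E} W with separating (map (_∘ suc) W)
... | α′ , sep′ = α , sep
  where
  K : ℕ
  K = suc (∑[ w ← W ] ℤ.∣ w zero ∣)
  α : Fin (suc E) → ℕ
  α zero    = 1
  α (suc e) = K * α′ e
  sep : ∀ {w} → w ∈ₗ W → dot α w ≡ 0ℤ → ∀ e → w e ≡ 0ℤ
  sep {w} w∈W dot≡0 with dot α′ (w ∘ suc) ℤ.≟ 0ℤ
  ... | yes t≡0 = λ
    { zero → trans (sym (ℤ.*-identityˡ (w zero))) (trans (sym (ℤ.+-identityʳ _)) (trans (cong (ℤ._+_ (ℤ.1ℤ ℤ.* w zero))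
        (sym (trans (dot-scale K α′ (w ∘ suc)) (trans (cong (+ K ℤ.*_) t≡0) (ℤ.*-zeroʳ (+ K)))))) dot≡0))
    ; (suc e) → sep′ (∈-map⁺ (_∘ suc) w∈W) t≡0 e }
  ... | no t≢0 = contradiction large (<⇒≱ (s≤s (term≤∑ (λ w → ℤ.∣ w zero ∣) w∈W)))
    where
    t = dot α′ (w ∘ suc)
    w₀≡ : w zero ≡ ℤ.- (+ K ℤ.* t)
    w₀≡ = begin
      w zero                                          ≡⟨ lemma (w zero) (+ K ℤ.* t) ⟩
      (ℤ.1ℤ ℤ.* w zero ℤ.+ + K ℤ.* t) ℤ.- + K ℤ.* t
        ≡⟨ cong (λ x → ℤ.1ℤ ℤ.* w zero ℤ.+ x ℤ.- + K ℤ.* t) (dot-scale K α′ (w ∘ suc)) ⟨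
      dot α w ℤ.- + K ℤ.* t                           ≡⟨ cong (λ x → x ℤ.- + K ℤ.* t) dot≡0 ⟩
      0ℤ ℤ.- + K ℤ.* t                                ≡⟨ ℤ.+-identityˡ _ ⟩
      ℤ.- (+ K ℤ.* t) ∎
      where
      open ≡-Reasoning
      lemma : ∀ a b → a ≡ (ℤ.1ℤ ℤ.* a ℤ.+ b) ℤ.- b
      lemma = ℤ-Solver.solve-∀
    large : K ≤ ℤ.∣ w zero ∣
    large = begin
      K                       ≤⟨ m≤m*n K ℤ.∣ t ∣ {{≢-nonZero (t≢0 ∘ ℤ.∣i∣≡0⇒i≡0)}} ⟩
      K * ℤ.∣ t ∣             ≡⟨ ℤ.abs-* (+ K) t ⟨
      ℤ.∣ + K ℤ.* t ∣         ≡⟨ ℤ.∣-i∣≡∣i∣ (+ K ℤ.* t) ⟨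
      ℤ.∣ ℤ.- (+ K ℤ.* t) ∣   ≡⟨ cong ℤ.∣_∣ w₀≡ ⟨
      ℤ.∣ w zero ∣ ∎
      where open ≤-Reasoning

-- Twice the signed area of the triangle abc vanishes; both sides are moved so that everything stays in ℕ.
CollinearTriple : (ax ay bx by cx cy : ℕ) → Set
CollinearTriple ax ay bx by cx cy = ax * by + bx * cy + cx * ay ≡ ax * cy + bx * ay + cx * by

det : (ax ay bx by cx cy : ℤ) → ℤ
det ax ay bx by cx cy = (bx ℤ.- ax) ℤ.* (cy ℤ.- ay) ℤ.- (cx ℤ.- ax) ℤ.* (by ℤ.- ay)

module _ (ax ay bx by cx cy : ℕ) where
  private
    pos₃ : ∀ a b c d e f → + (a * b + c * d + e * f) ≡ + a ℤ.* + b ℤ.+ + c ℤ.* + d ℤ.+ + e ℤ.* + f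
    pos₃ a b c d e f = trans (ℤ.pos-+ (a * b + c * d) (e * f))
      (cong₂ ℤ._+_ (trans (ℤ.pos-+ (a * b) (c * d)) (cong₂ ℤ._+_ (ℤ.pos-* a b) (ℤ.pos-* c d))) (ℤ.pos-* e f))
    L R : ℤ
    L = + ax ℤ.* + by ℤ.+ + bx ℤ.* + cy ℤ.+ + cx ℤ.* + ay
    R = + ax ℤ.* + cy ℤ.+ + bx ℤ.* + ay ℤ.+ + cx ℤ.* + by
    expand : ∀ ax ay bx by cx cy → (bx ℤ.- ax) ℤ.* (cy ℤ.- ay) ℤ.- (cx ℤ.- ax) ℤ.* (by ℤ.- ay)
             ≡ (ax ℤ.* by ℤ.+ bx ℤ.* cy ℤ.+ cx ℤ.* ay) ℤ.- (ax ℤ.* cy ℤ.+ bx ℤ.* ay ℤ.+ cx ℤ.* by)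
    expand = ℤ-Solver.solve-∀

  collinear⇒det : CollinearTriple ax ay bx by cx cy → det (+ ax) (+ ay) (+ bx) (+ by) (+ cx) (+ cy) ≡ 0ℤ
  collinear⇒det eq = trans (expand (+ ax) (+ ay) (+ bx) (+ by) (+ cx) (+ cy))
    (ℤ.i≡j⇒i-j≡0 {L} {R} (trans (sym (pos₃ ax by bx cy cx ay)) (trans (cong +_ eq) (pos₃ ax cy bx ay cx by))))

  det⇒collinear : det (+ ax) (+ ay) (+ bx) (+ by) (+ cx) (+ cy) ≡ 0ℤ → CollinearTriple ax ay bx by cx cy
  det⇒collinear eq = ℤ.+-injective (trans (pos₃ ax by bx cy cx ay) (trans
    (ℤ.i-j≡0⇒i≡j L R (trans (sym (expand (+ ax) (+ ay) (+ bx) (+ by) (+ cx) (+ cy))) eq))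
    (sym (pos₃ ax cy bx ay cx by))))

-- The vectors `(x′ , y′)` and `(x , y)` have ratio `r/s`; multiplied by `s`, their determinant
-- cancels.
cross : ∀ s r x x′ y y′ → s ≢ 0ℤ → s ℤ.* x′ ≡ r ℤ.* x → s ℤ.* y′ ≡ r ℤ.* y → x ℤ.* y′ ℤ.- x′ ℤ.* y ≡ 0ℤ
cross s r x x′ y y′ s≢0 eqx eqy = [ (λ s≡0 → contradiction s≡0 s≢0) , id ]′ (ℤ.i*j≡0⇒i≡0∨j≡0 s {x ℤ.* y′ ℤ.- x′ ℤ.* y} multiple)
  where
  distribute : ∀ s a b c d → s ℤ.* (a ℤ.* b ℤ.- c ℤ.* d) ≡ a ℤ.* (s ℤ.* b) ℤ.- s ℤ.* c ℤ.* d
  distribute = ℤ-Solver.solve-∀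
  cancel : ∀ r a b → a ℤ.* (r ℤ.* b) ℤ.- r ℤ.* a ℤ.* b ≡ 0ℤ
  cancel = ℤ-Solver.solve-∀
  multiple : s ℤ.* (x ℤ.* y′ ℤ.- x′ ℤ.* y) ≡ 0ℤ
  multiple = trans (distribute s x y′ x′ y) (trans (cong₂ (λ u v → x ℤ.* u ℤ.- v ℤ.* y) eqy eqx) (cancel r x y))

-- In `aligned⇒proportional` the scalars are differences of `X`, so one ratio serves all coordinates
-- of `V` simultaneously.
record FaithfulProjection {N E : ℕ} (V : Fin N → Fin E → ℕ) : Set where
  field
    X Y : Fin N → ℕ

  Aligned : Fin N → Fin N → Fin N → Set
  Aligned a b c = CollinearTriple (X a) (Y a) (X b) (Y b) (X c) (Y c)

  field
    X-separates : ∀ a b → X a ≡ X b → ∀ e → V a e ≡ V b e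
    aligned⇒proportional : ∀ a b c → Aligned a b c → ∀ e →
      (+ X b ℤ.- + X a) ℤ.* (+ V c e ℤ.- + V a e) ≡ (+ X c ℤ.- + X a) ℤ.* (+ V b e ℤ.- + V a e)
    proportional⇒aligned : ∀ a b c s r → s ≢ 0ℤ →
      (∀ e → s ℤ.* (+ V c e ℤ.- + V a e) ≡ r ℤ.* (+ V b e ℤ.- + V a e)) → Aligned a b c

-- First X separates the points, then Y avoids the finitely many vectors (X b − X a)(V c − V a) − (X c − X a)(V b − V a).
module Projection {N E : ℕ} (V : Fin N → Fin E → ℕ) where

  diff : Fin N → Fin N → Fin E → ℤ
  diff a b e = + V b e ℤ.- + V a e

  dotℕ : ∀ {E} → (Fin E → ℕ) → (Fin E → ℕ) → ℕ
  dotℕ {zero}  α v = 0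
  dotℕ {suc E} α v = α zero * v zero + dotℕ (α ∘ suc) (v ∘ suc)

  dotℕ-pos : ∀ {E} (α v : Fin E → ℕ) → + dotℕ α v ≡ dot α (+_ ∘ v)
  dotℕ-pos {zero}  α v = refl
  dotℕ-pos {suc E} α v = trans (ℤ.pos-+ (α zero * v zero) _) (cong₂ ℤ._+_ (ℤ.pos-* (α zero) (v zero)) (dotℕ-pos (α ∘ suc) (v ∘ suc)))

  dot-diff : ∀ α a b → dot α (diff a b) ≡ + dotℕ α (V b) ℤ.- + dotℕ α (V a)
  dot-diff α a b = begin
    dot α (diff a b)
      ≡⟨ dot-cong α (λ e → cong₂ ℤ._-_ (sym (ℤ.*-identityˡ (+ V b e))) (sym (ℤ.*-identityˡ (+ V a e)))) ⟩
    dot α (λ e → ℤ.1ℤ ℤ.* + V b e ℤ.- ℤ.1ℤ ℤ.* + V a e)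
      ≡⟨ dot-comb α ℤ.1ℤ ℤ.1ℤ _ _ ⟩
    ℤ.1ℤ ℤ.* dot α (+_ ∘ V b) ℤ.- ℤ.1ℤ ℤ.* dot α (+_ ∘ V a)
      ≡⟨ cong₂ ℤ._-_ (trans (ℤ.*-identityˡ _) (sym (dotℕ-pos α (V b)))) (trans (ℤ.*-identityˡ _) (sym (dotℕ-pos α (V a)))) ⟩
    + dotℕ α (V b) ℤ.- + dotℕ α (V a) ∎
    where open ≡-Reasoning

  private
    first = separating (cartesianProductWith diff (allFin N) (allFin N))

  X : Fin N → ℕ
  X a = dotℕ (proj₁ first) (V a)

  ΔX : Fin N → Fin N → ℤ
  ΔX a b = + X b ℤ.- + X a

  X-separates : ∀ a b → ΔX a b ≡ 0ℤ → ∀ e → V a e ≡ V b e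
  X-separates a b eq e = sym (ℤ.+-injective (ℤ.i-j≡0⇒i≡j (+ V b e) (+ V a e)
    (proj₂ first (∈-cartesianProductWith⁺ diff (∈-allFin a) (∈-allFin b)) (trans (dot-diff (proj₁ first) a b) eq) e)))

  area : Fin N → Fin N × Fin N → Fin E → ℤ
  area a (b , c) e = ΔX a b ℤ.* diff a c e ℤ.- ΔX a c ℤ.* diff a b e

  private
    second = separating (cartesianProductWith area (allFin N)
                          (cartesianProductWith _,_ (allFin N) (allFin N)))

  Y : Fin N → ℕ
  Y a = dotℕ (proj₁ second) (V a)

  Aligned : Fin N → Fin N → Fin N → Set
  Aligned a b c = CollinearTriple (X a) (Y a) (X b) (Y b) (X c) (Y c)

  -- Applied to `area`, the second functional gives the determinant of the projected triangle. If
  -- that is zero, `area` vanishes by the choice of the functional.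
  aligned⇒proportional : ∀ a b c → Aligned a b c → ∀ e → ΔX a b ℤ.* diff a c e ≡ ΔX a c ℤ.* diff a b e
  aligned⇒proportional a b c al e = ℤ.i-j≡0⇒i≡j (ΔX a b ℤ.* diff a c e) (ΔX a c ℤ.* diff a b e)
    (proj₂ second {area a (b , c)} (∈-cartesianProductWith⁺ area (∈-allFin a) (∈-cartesianProductWith⁺ _,_ (∈-allFin b) (∈-allFin c)))
      (begin
        dot (proj₁ second) (area a (b , c))
          ≡⟨ dot-comb (proj₁ second) (ΔX a b) (ΔX a c) (diff a c) (diff a b) ⟩
        ΔX a b ℤ.* dot (proj₁ second) (diff a c) ℤ.- ΔX a c ℤ.* dot (proj₁ second) (diff a b)
          ≡⟨ cong₂ (λ u v → ΔX a b ℤ.* u ℤ.- ΔX a c ℤ.* v) (dot-diff (proj₁ second) a c) (dot-diff (proj₁ second) a b) ⟩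
        det (+ X a) (+ Y a) (+ X b) (+ Y b) (+ X c) (+ Y c)
          ≡⟨ collinear⇒det (X a) (Y a) (X b) (Y b) (X c) (Y c) al ⟩
        0ℤ ∎) e)
    where open ≡-Reasoning

  private
    image : ∀ α a b c s r → (∀ e → s ℤ.* diff a c e ≡ r ℤ.* diff a b e) →
            s ℤ.* (+ dotℕ α (V c) ℤ.- + dotℕ α (V a)) ≡ r ℤ.* (+ dotℕ α (V b) ℤ.- + dotℕ α (V a))
    image α a b c s r prop = subst₂ (λ u v → s ℤ.* u ≡ r ℤ.* v) (dot-diff α a c) (dot-diff α a b)
      (ℤ.i-j≡0⇒i≡j (s ℤ.* dot α (diff a c)) (r ℤ.* dot α (diff a b))
        (trans (sym (dot-comb α s r (diff a c) (diff a b)))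
               (dot-zero α (λ e → ℤ.i≡j⇒i-j≡0 {s ℤ.* diff a c e} {r ℤ.* diff a b e} (prop e)))))

  proportional⇒aligned : ∀ a b c s r → s ≢ 0ℤ → (∀ e → s ℤ.* diff a c e ≡ r ℤ.* diff a b e) → Aligned a b c
  proportional⇒aligned a b c s r s≢0 prop = det⇒collinear (X a) (Y a) (X b) (Y b) (X c) (Y c)
    (cross s r (ΔX a b) (ΔX a c) (+ Y b ℤ.- + Y a) (+ Y c ℤ.- + Y a) s≢0
      (image (proj₁ first) a b c s r prop) (image (proj₁ second) a b c s r prop))

abstract
  faithfulProjection : ∀ {N E} (V : Fin N → Fin E → ℕ) → FaithfulProjection V
  faithfulProjection V = record
    { X = X ; Y = Y
    ; X-separates = λ a b eq → X-separates a b (ℤ.i≡j⇒i-j≡0 {+ X b} {+ X a} (cong +_ (sym eq)))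
    ; aligned⇒proportional = aligned⇒proportional ; proportional⇒aligned = proportional⇒aligned }
    where open Projection V

-- Lifting by quadratic monomials

quadratic : ∀ s r xa xb xc ya yb yc → s ≢ 0ℤ →
  s ℤ.* (xc ℤ.- xa) ≡ r ℤ.* (xb ℤ.- xa) → s ℤ.* (yc ℤ.- ya) ≡ r ℤ.* (yb ℤ.- ya) →
  s ℤ.* (xc ℤ.* yc ℤ.- xa ℤ.* ya) ≡ r ℤ.* (xb ℤ.* yb ℤ.- xa ℤ.* ya) → xc ≡ xa ⊎ yc ≡ yb
quadratic s r xa xb xc ya yb yc s≢0 eqx eqy eqxy =
  [ (λ s≡0 → contradiction s≡0 s≢0)
  , (λ product≡0 → [ inj₁ ∘ ℤ.i-j≡0⇒i≡j xc xa , inj₂ ∘ ℤ.i-j≡0⇒i≡j yc yb ]′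
                     (ℤ.i*j≡0⇒i≡0∨j≡0 (xc ℤ.- xa) {yc ℤ.- yb} product≡0))
  ]′ (ℤ.i*j≡0⇒i≡0∨j≡0 s {(xc ℤ.- xa) ℤ.* (yc ℤ.- yb)} multiple)
  where
  expand : ∀ s xa xc ya yb yc → s ℤ.* ((xc ℤ.- xa) ℤ.* (yc ℤ.- yb)) ≡
    s ℤ.* (xc ℤ.* yc ℤ.- xa ℤ.* ya) ℤ.- xa ℤ.* (s ℤ.* (yc ℤ.- ya)) ℤ.- ya ℤ.* (s ℤ.* (xc ℤ.- xa))
      ℤ.- s ℤ.* (xc ℤ.- xa) ℤ.* (yb ℤ.- ya)
  expand = ℤ-Solver.solve-∀
  cancel : ∀ r xa xb ya yb → r ℤ.* (xb ℤ.* yb ℤ.- xa ℤ.* ya) ℤ.- xa ℤ.* (r ℤ.* (yb ℤ.- ya)) ℤ.- ya ℤ.* (r ℤ.* (xb ℤ.- xa))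
      ℤ.- r ℤ.* (xb ℤ.- xa) ℤ.* (yb ℤ.- ya) ≡ 0ℤ
  cancel = ℤ-Solver.solve-∀
  -- At a point `c` dividing `ab` in the ratio given by `r/s`, the product `xy` differs from its
  -- linear interpolation between `a` and `b` by exactly `(xc − xa)(yc − yb)`.
  multiple : s ℤ.* ((xc ℤ.- xa) ℤ.* (yc ℤ.- yb)) ≡ 0ℤ
  multiple = trans (expand s xa xc ya yb yc) (trans
    (cong₂ (λ u v → u ℤ.- xa ℤ.* v ℤ.- ya ℤ.* (s ℤ.* (xc ℤ.- xa)) ℤ.- s ℤ.* (xc ℤ.- xa) ℤ.* (yb ℤ.- ya)) eqxy eqy)
    (trans (cong (λ u → r ℤ.* (xb ℤ.* yb ℤ.- xa ℤ.* ya) ℤ.- xa ℤ.* (r ℤ.* (yb ℤ.- ya)) ℤ.- ya ℤ.* u ℤ.- u ℤ.* (yb ℤ.- ya)) eqx)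
      (cancel r xa xb ya yb)))

-- Lifting points by the monomials z i · z j, where z 0 = 1 and the squares of z i for i ≥ 2 are left out, keeps exactly
-- the collinear triples lying on a line parallel to one of the axes i ≥ 2.
module Lift {N D : ℕ} (z : Fin N → Fin (2 + D) → ℕ) (z-one : ∀ a → z a zero ≡ 1) where

  Mixed : Fin (2 + D) → Fin (2 + D) → Set
  Mixed i j = i ≢ j ⊎ toℕ i ≤ 1

  mixed? : ∀ i j → Dec (Mixed i j)
  mixed? i j = ¬? (i ≟F j) ⊎-dec (toℕ i ≤? 1)

  monomial : Fin N → Fin (2 + D) × Fin (2 + D) → ℕ
  monomial a (i , j) = 𝟙 (mixed? i j) * (z a i * z a j)

  monomial-mixed : ∀ a {i j} → Mixed i j → monomial a (i , j) ≡ z a i * z a j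
  monomial-mixed a {i} {j} mix = trans (cong (_* (z a i * z a j)) (𝟙-true (mixed? i j) mix)) (*-identityˡ _)

  abstract
    V : Fin N → Fin ((2 + D) * (2 + D)) → ℕ
    V a e = monomial a (remQuot (2 + D) e)

    V-mixed : ∀ a {i j} → Mixed i j → V a (combine i j) ≡ z a i * z a j
    V-mixed a {i} {j} mix = trans (cong (monomial a) (remQuot-combine i j)) (monomial-mixed a mix)

    V-monomial : (P : ℕ → ℕ → ℕ → Set) → ∀ a b c → (∀ ij → P (monomial a ij) (monomial b ij) (monomial c ij)) →
                 ∀ e → P (V a e) (V b e) (V c e)
    V-monomial P a b c p e = p (remQuot (2 + D) e)

  open FaithfulProjection (faithfulProjection V) public

  ΔX : Fin N → Fin N → ℤ
  ΔX a b = + X b ℤ.- + X a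

  Apart : Fin N → Fin N → Set
  Apart a b = ∃ λ i → z a i ≢ z b i

  V-linear : ∀ a i → V a (combine {2 + D} zero i) ≡ z a i
  V-linear a i = trans (V-mixed a (inj₂ z≤n)) (trans (cong (_* z a i) (z-one a)) (*-identityˡ _))

  X-injective : ∀ a b → X a ≡ X b → ∀ i → z a i ≡ z b i
  X-injective a b eq i = subst₂ _≡_ (V-linear a i) (V-linear b i)
    (X-separates a b eq (combine {2 + D} zero i))

  module _ (a b c : Fin N) where

    -- `quadratic` for the coordinates `i` and `j` with the scalars `ΔX a b` and `ΔX a c`; the first
    -- is nonzero because `X` separates points that are apart.
    dichotomy : Apart a b → Aligned a b c → ∀ i j → Mixed i j → z c i ≡ z a i ⊎ z c j ≡ z b j
    dichotomy (l , za≢zb) al i j mix = [ inj₁ ∘ ℤ.+-injective , inj₂ ∘ ℤ.+-injective ]′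
      (quadratic (ΔX a b) (ΔX a c) (+ z a i) (+ z b i) (+ z c i) (+ z a j) (+ z b j) (+ z c j) s≢0 (linear i) (linear j) mixed)
      where
      s≢0 : ΔX a b ≢ 0ℤ
      s≢0 eq = za≢zb (X-injective a b (sym (ℤ.+-injective (ℤ.i-j≡0⇒i≡j (+ X b) (+ X a) eq))) l)
      at : ∀ e {u v w} → V a e ≡ u → V b e ≡ v → V c e ≡ w →
           ΔX a b ℤ.* (+ w ℤ.- + u) ≡ ΔX a c ℤ.* (+ v ℤ.- + u)
      at e refl refl refl = aligned⇒proportional a b c al e
      linear : ∀ i → ΔX a b ℤ.* (+ z c i ℤ.- + z a i) ≡ ΔX a c ℤ.* (+ z b i ℤ.- + z a i)
      linear i = at (combine {2 + D} zero i) (V-linear a i) (V-linear b i) (V-linear c i)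
      mixed : ΔX a b ℤ.* (+ z c i ℤ.* + z c j ℤ.- + z a i ℤ.* + z a j) ≡ ΔX a c ℤ.* (+ z b i ℤ.* + z b j ℤ.- + z a i ℤ.* + z a j)
      mixed = subst (λ u → ΔX a b ℤ.* (+ z c i ℤ.* + z c j ℤ.- u) ≡ ΔX a c ℤ.* (+ z b i ℤ.* + z b j ℤ.- u)) (ℤ.pos-* (z a i) (z a j))
        (subst₂ (λ v w → ΔX a b ℤ.* (w ℤ.- + (z a i * z a j)) ≡ ΔX a c ℤ.* (v ℤ.- + (z a i * z a j)))
          (ℤ.pos-* (z b i) (z b j)) (ℤ.pos-* (z c i) (z c j)) (at (combine i j) (V-mixed a mix) (V-mixed b mix) (V-mixed c mix)))

    -- Let `c` differ from `a` in coordinate `i` and from `b` in coordinate `l`. By `dichotomy`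
    -- their product is not a retained monomial, so `i` and `l` are the same coordinate beyond 1.
    -- Pairing it with any other `j`, in both orders, shows that `j` is constant.
    aligned⇒axis : Apart a b → Apart c a → Apart c b → Aligned a b c →
                   ∃ λ i → 1 < toℕ i × (∀ j → j ≢ i → z c j ≡ z a j × z c j ≡ z b j)
    aligned⇒axis ab (i , ca) (l , cb) al with mixed? i l
    ... | yes mix = [ (λ eq → contradiction eq ca) , (λ eq → contradiction eq cb) ]′ (dichotomy ab al i l mix)
    ... | no ¬mix with decidable-stable (i ≟F l) (¬mix ∘ inj₁)
    ...   | refl = i , ≰⇒> (¬mix ∘ inj₂) , λ j j≢i →
              [ id , (λ eq → contradiction eq cb) ]′ (dichotomy ab al j i (inj₁ j≢i)) ,
              [ (λ eq → contradiction eq ca) , id ]′ (dichotomy ab al i j (inj₁ (j≢i ∘ sym)))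

    -- If only coordinate `i` varies, every retained monomial is affine in it, as its square is left
    -- out.
    axis⇒aligned : ∀ i → 1 < toℕ i → (∀ j → j ≢ i → z a j ≡ z c j × z b j ≡ z c j) → z a i ≢ z b i → Aligned a b c
    axis⇒aligned i 1<i const za≢zb = proportional⇒aligned a b c (+ z b i ℤ.- + z a i) (+ z c i ℤ.- + z a i)
      (λ eq → za≢zb (sym (ℤ.+-injective (ℤ.i-j≡0⇒i≡j (+ z b i) (+ z a i) eq))))
      (V-monomial Proportional a b c proportional)
      where
      Proportional : ℕ → ℕ → ℕ → Set
      Proportional u v w = (+ z b i ℤ.- + z a i) ℤ.* (+ w ℤ.- + u) ≡ (+ z c i ℤ.- + z a i) ℤ.* (+ v ℤ.- + u)
      still : ∀ {u v w} → u ≡ w → v ≡ w → Proportional u v w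
      still {u} refl refl = lemma (+ z b i ℤ.- + z a i) (+ z c i ℤ.- + z a i) (+ u)
        where lemma : ∀ s r u → s ℤ.* (u ℤ.- u) ≡ r ℤ.* (u ℤ.- u)
              lemma = ℤ-Solver.solve-∀
      moving : ∀ y → Proportional (z a i * y) (z b i * y) (z c i * y)
      moving y rewrite ℤ.pos-* (z a i) y | ℤ.pos-* (z b i) y | ℤ.pos-* (z c i) y = lemma (+ z a i) (+ z b i) (+ z c i) (+ y)
        where lemma : ∀ a b c y → (b ℤ.- a) ℤ.* (c ℤ.* y ℤ.- a ℤ.* y) ≡ (c ℤ.- a) ℤ.* (b ℤ.* y ℤ.- a ℤ.* y)
              lemma = ℤ-Solver.solve-∀
      moving′ : ∀ {u v w p q r} → p ≡ r → q ≡ r → u ≡ z a i * p → v ≡ z b i * q → w ≡ z c i * r → Proportional u v w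
      moving′ {r = r} refl refl refl refl refl = moving r
      proportional : ∀ pq → Proportional (monomial a pq) (monomial b pq) (monomial c pq)
      proportional (p , q) with mixed? p q
      ... | no _ = still {0} {0} {0} refl refl
      ... | yes mix with p ≟F i | q ≟F i
      ...   | no p≢i | no q≢i = still (cong₂ (λ u v → 1 * (u * v)) (proj₁ (const p p≢i)) (proj₁ (const q q≢i)))
                                      (cong₂ (λ u v → 1 * (u * v)) (proj₂ (const p p≢i)) (proj₂ (const q q≢i)))
      ...   | yes refl | no q≢i = moving′ (proj₁ (const q q≢i)) (proj₂ (const q q≢i))
                (*-identityˡ _) (*-identityˡ _) (*-identityˡ _)
      ...   | no p≢i | yes refl = moving′ (proj₁ (const p p≢i)) (proj₂ (const p p≢i))
                (swap (z a p) (z a i)) (swap (z b p) (z b i)) (swap (z c p) (z c i))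
        where swap : ∀ u v → 1 * (u * v) ≡ v * u
              swap u v = trans (*-identityˡ _) (*-comm u v)
      ...   | yes refl | yes refl = contradiction mix λ { (inj₁ ne) → ne refl ; (inj₂ i≤1) → <⇒≱ 1<i i≤1 }

-- The t-th copy of the configuration gets the extra coordinate z 1 = t, whose square is among the monomials.
module Copies {m D k n : ℕ} (cfg : Configuration (Grid.grid m D) k n) (T : ℕ) where
  open Configuration cfg
  open Grid m using (Parallel; parallel-meet; lookup-ext)
  open Extraction (Grid.grid m D) using (Unaligned)

  copyOf : Fin (T * size) → Fin T
  copyOf a = proj₁ (remQuot {T} size a)

  inCopy : Fin (T * size) → Fin size
  inCopy a = proj₂ (remQuot {T} size a)

  z : Fin (T * size) → Fin (2 + D) → ℕ
  z a zero          = 1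
  z a (suc zero)    = toℕ (copyOf a)
  z a (suc (suc i)) = toℕ (lookup (point (inCopy a)) i)

  open Lift z (λ _ → refl) public

  z-injective : ∀ a b → (∀ i → z a i ≡ z b i) → a ≡ b
  z-injective a b eq = trans (sym (combine-remQuot {T} size a)) (trans
    (cong₂ combine (toℕ-injective (eq (suc zero)))
      (injective (lookup-ext _ _ λ i → toℕ-injective (eq (suc (suc i))))))
    (combine-remQuot {T} size b))

  apart : ∀ {a b} → a ≢ b → Apart a b
  apart {a} {b} a≢b with any? (λ i → ¬? (z a i ≟ z b i))
  ... | yes ap = ap
  ... | no ¬ap = contradiction (z-injective a b λ i → decidable-stable (z a i ≟ z b i) λ ne → ¬ap (i , ne)) a≢b

  X-distinct : ∀ {a b} → X a ≡ X b → a ≡ b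
  X-distinct {a} {b} eq = z-injective a b (X-injective a b eq)

  -- The varying coordinate belongs to the grid, so the copy index, coordinate 1, is constant on the
  -- triple.
  aligned⇒parallel : ∀ a b c → a ≢ b → a ≢ c → b ≢ c → Aligned a b c →
    copyOf a ≡ copyOf b × ∃ λ i → Parallel (point (inCopy a)) i (point (inCopy b)) × Parallel (point (inCopy a)) i (point (inCopy c))
  aligned⇒parallel a b c ab ac bc al with aligned⇒axis a b c (apart ab) (apart (ac ∘ sym)) (apart (bc ∘ sym)) al
  ... | suc zero , s≤s () , _
  ... | suc (suc i) , _ , same =
    toℕ-injective (let ca , cb = same (suc zero) (λ ()) in trans (sym ca) cb) , i ,
    (λ j ne → toℕ-injective (let ca , cb = same (suc (suc j)) (ne ∘ suc-injective ∘ suc-injective) in trans (sym ca) cb)) ,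
    (λ j ne → toℕ-injective (sym (proj₁ (same (suc (suc j)) (ne ∘ suc-injective ∘ suc-injective)))))

  inCopy-distinct : ∀ {a b} → copyOf a ≡ copyOf b → a ≢ b → inCopy a ≢ inCopy b
  inCopy-distinct {a} {b} t p≢ eq = p≢ (trans (sym (combine-remQuot {T} size a))
    (trans (cong₂ combine t eq) (combine-remQuot {T} size b)))

  noFourAligned : ∀ a b c e → a ≢ b → a ≢ c → a ≢ e → b ≢ c → b ≢ e → c ≢ e →
                  ¬ (Aligned a b c × Aligned a b e × Aligned a c e)
  noFourAligned a b c e ab ac ae bc be ce (abc , abe , ace)
    with aligned⇒parallel a b c ab ac bc abc | aligned⇒parallel a b e ab ae be abe | aligned⇒parallel a c e ac ae ce ace
  ... | tb , i , pb , pc | _ , j , pb′ , pe | tc , l , pc′ , pe′ =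
    noFour i (inCopy a) (inCopy b) (inCopy c) (inCopy e)
      (inCopy-distinct tb ab) (inCopy-distinct tc ac) (inCopy-distinct te ae)
      (inCopy-distinct (trans (sym tb) tc) bc) (inCopy-distinct (trans (sym tb) te) be) (inCopy-distinct (trans (sym tc) te) ce)
      (pb , pc , subst (λ i → Parallel (point (inCopy a)) i (point (inCopy e))) (sym i≡j) pe)
    where
    te : copyOf a ≡ copyOf e
    te = proj₁ (aligned⇒parallel a e b ae ab (be ∘ sym) (transpose abe))
      where
      transpose : Aligned a b e → Aligned a e b
      transpose eq = sym (subst₂ _≡_ (swap-lr (X a * Y b) (X b * Y e) (X e * Y a)) (swap-lr (X a * Y e) (X b * Y a) (X e * Y b)) eq)
        where
        swap-lr : ∀ u v w → u + v + w ≡ u + w + v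
        swap-lr u v w = trans (+-assoc u v w) (trans (cong (λ x → u + x) (+-comm v w)) (sym (+-assoc u w v)))
    -- `a` and `b` are distinct points of one copy, so only one direction joins them.
    i≡j : i ≡ j
    i≡j = parallel-meet (λ eq → inCopy-distinct tb ab (injective eq)) pb pb′

  parallel⇒aligned : ∀ a b c i → copyOf a ≡ copyOf c → copyOf b ≡ copyOf c → a ≢ b →
    Parallel (point (inCopy a)) i (point (inCopy c)) → Parallel (point (inCopy b)) i (point (inCopy c)) → Aligned a b c
  parallel⇒aligned a b c i ta tb a≢b pa pb = axis⇒aligned a b c (suc (suc i)) (s≤s (s≤s z≤n)) const differ
    where
    const : ∀ j → j ≢ suc (suc i) → z a j ≡ z c j × z b j ≡ z c j
    const zero          _  = refl , refl
    const (suc zero)    _  = cong toℕ ta , cong toℕ tb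
    const (suc (suc j)) ne = cong toℕ (pa j (ne ∘ cong (λ l → Fin.suc (Fin.suc l)))) , cong toℕ (pb j (ne ∘ cong (λ l → Fin.suc (Fin.suc l))))
    differ : z a (suc (suc i)) ≢ z b (suc (suc i))
    differ eq = a≢b (z-injective a b λ j → agree j)
      where
      agree : ∀ j → z a j ≡ z b j
      agree j with j ≟F suc (suc i)
      ... | yes refl = eq
      ... | no ne    = trans (proj₁ (const j ne)) (sym (proj₂ (const j ne)))

-- Lines in the real plane

module RealPlane (ℝ : RealField) where
  open RealField ℝ using (Carrier; 0#; 1#; isCommutativeRing; inverse; *-nonneg; 0≢1)
    renaming (_+_ to _⊕_; _*_ to _⊗_; -_ to ⊖_; _≤_ to _≼_; ≤-trans to ≼-trans; ≤-refl to ≼-refl; ≤-total to ≼-total; ≤-antisym to ≼-antisym; +-mono-≤ to ⊕-mono-≼)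
  open Plane ℝ

  ring : CommutativeRing _ _
  ring = record { isCommutativeRing = isCommutativeRing }

  private
    module K = CommutativeRing ring
    module KP = RingProperties K.ring
    module Mult = SemiringMult K.semiring
  open SemiringSolver K.commutativeSemiring using (solve; _:+_; _:*_; _:=_)

  ι : ℕ → Carrier
  ι n = n Mult.× 1#

  ι-+ : ∀ a b → ι (a + b) ≡ ι a ⊕ ι b
  ι-+ = Mult.×-homo-+ 1#

  ι-* : ∀ a b → ι (a * b) ≡ ι a ⊗ ι b
  ι-* = Mult.×1-homo-*

  0≼1 : 0# ≼ 1#
  0≼1 with ≼-total 0# 1#
  ... | inj₁ 0≼1 = 0≼1
  ... | inj₂ 1≼0 = subst (0# ≼_) square (*-nonneg 0≼-1 0≼-1)
    where
    0≼-1 : 0# ≼ ⊖ 1#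
    0≼-1 = subst₂ _≼_ (K.-‿inverseʳ 1#) (K.+-identityˡ (⊖ 1#)) (⊕-mono-≼ (⊖ 1#) 1≼0)
    square : (⊖ 1#) ⊗ (⊖ 1#) ≡ 1#
    square = trans (sym (KP.-‿distribˡ-* 1# (⊖ 1#))) (trans (cong ⊖_ (K.*-identityˡ (⊖ 1#))) (KP.-‿involutive 1#))

  ι-nonneg : ∀ n → 0# ≼ ι n
  ι-nonneg zero    = ≼-refl 0#
  ι-nonneg (suc n) = ≼-trans (ι-nonneg n) (subst (_≼ ι (suc n)) (K.+-identityˡ (ι n)) (⊕-mono-≼ (ι n) 0≼1))

  -- Characteristic zero comes from the order: `ι (suc n)` is at least `1#`, so its vanishing would
  -- give `1# ≼ 0#`.
  ι-suc≢0 : ∀ n → ι (suc n) ≢ 0#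
  ι-suc≢0 n eq = 0≢1 (≼-antisym 0≼1 (subst (1# ≼_) eq
    (subst₂ _≼_ (K.+-identityˡ 1#) (K.+-comm (ι n) 1#) (⊕-mono-≼ 1# (ι-nonneg n)))))

  ι-distinct : ∀ {a b} → a < b → ι a ≢ ι b
  ι-distinct {a} {b} a<b eq = ι-suc≢0 (b ∸ suc a) (KP.+-cancelˡ (ι a) (ι (suc (b ∸ suc a))) 0# (begin
    ι a ⊕ ι (suc (b ∸ suc a))  ≡⟨ ι-+ a (suc (b ∸ suc a)) ⟨
    ι (a + suc (b ∸ suc a))    ≡⟨ cong ι (trans (+-suc a _) (m+[n∸m]≡n a<b)) ⟩
    ι b                        ≡⟨ eq ⟨
    ι a                        ≡⟨ K.+-identityʳ (ι a) ⟨
    ι a ⊕ 0# ∎))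
    where open ≡-Reasoning

  ι-injective : ∀ {a b} → ι a ≡ ι b → a ≡ b
  ι-injective {a} {b} eq with <-cmp a b
  ... | tri< a<b _ _ = contradiction eq (ι-distinct a<b)
  ... | tri≈ _ a≡b _ = a≡b
  ... | tri> _ _ b<a = contradiction (sym eq) (ι-distinct b<a)

  cancel-≢ : ∀ a {u v} → a ⊗ u ≡ a ⊗ v → u ≢ v → a ≡ 0#
  cancel-≢ a {u} {v} eq u≢v = begin
    a                       ≡⟨ K.*-identityʳ a ⟨
    a ⊗ 1#                  ≡⟨ cong (a ⊗_) (proj₂ inv) ⟨
    a ⊗ ((u ⊕ ⊖ v) ⊗ w)     ≡⟨ K.*-assoc a _ w ⟨
    a ⊗ (u ⊕ ⊖ v) ⊗ w       ≡⟨ cong (_⊗ w) (begin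
      a ⊗ (u ⊕ ⊖ v)           ≡⟨ K.distribˡ a u (⊖ v) ⟩
      a ⊗ u ⊕ a ⊗ (⊖ v)       ≡⟨ cong₂ _⊕_ eq (sym (KP.-‿distribʳ-* a v)) ⟩
      a ⊗ v ⊕ ⊖ (a ⊗ v)       ≡⟨ K.-‿inverseʳ (a ⊗ v) ⟩
      0# ∎) ⟩
    0# ⊗ w                  ≡⟨ K.zeroˡ w ⟩
    0# ∎
    where
    open ≡-Reasoning
    inv = inverse (u ⊕ ⊖ v) (λ z → u≢v (KP.x∙y⁻¹≈ε⇒x≈y u v z))
    w = proj₁ inv

  module _ (ax ay bx by cx cy : Carrier) where

    Lhs Rhs : Carrier
    Lhs = ax ⊗ by ⊕ bx ⊗ cy ⊕ cx ⊗ ay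
    Rhs = ax ⊗ cy ⊕ bx ⊗ ay ⊕ cx ⊗ by

    -- The line equations show that both `a` and `b` annihilate the difference of `Lhs` and `Rhs`,
    -- so a nonzero difference makes the line degenerate. The double negation remains because real
    -- equality is not decidable here; for natural coordinates it is removed in `onLine⇒collinear`.
    onLine⇒area : (L : Line) → (ax , ay) OnLine L → (bx , by) OnLine L → (cx , cy) OnLine L → ¬ (Lhs ≢ Rhs)
    onLine⇒area (line a b c nonDeg) ea eb ec ne = nonDeg (cancel-≢ a a-eq ne , cancel-≢ b b-eq ne)
      where
      open ≡-Reasoning
      a-eq : a ⊗ Lhs ≡ a ⊗ Rhs
      a-eq = KP.+-cancelʳ (b ⊗ (ay ⊗ by ⊕ by ⊗ cy ⊕ cy ⊗ ay)) _ _ (begin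
        a ⊗ Lhs ⊕ b ⊗ (ay ⊗ by ⊕ by ⊗ cy ⊕ cy ⊗ ay)
          ≡⟨ solve 8 (λ a b ax ay bx by cx cy →
               a :* (ax :* by :+ bx :* cy :+ cx :* ay) :+ b :* (ay :* by :+ by :* cy :+ cy :* ay)
               := (a :* ax :+ b :* ay) :* by :+ (a :* bx :+ b :* by) :* cy :+ (a :* cx :+ b :* cy) :* ay)
               refl a b ax ay bx by cx cy ⟩
        (a ⊗ ax ⊕ b ⊗ ay) ⊗ by ⊕ (a ⊗ bx ⊕ b ⊗ by) ⊗ cy ⊕ (a ⊗ cx ⊕ b ⊗ cy) ⊗ ay
          ≡⟨ cong₂ _⊕_ (cong₂ _⊕_ (cong (_⊗ by) (trans ea (sym ec))) (cong (_⊗ cy) (trans eb (sym ea)))) (cong (_⊗ ay) (trans ec (sym eb))) ⟩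
        (a ⊗ cx ⊕ b ⊗ cy) ⊗ by ⊕ (a ⊗ ax ⊕ b ⊗ ay) ⊗ cy ⊕ (a ⊗ bx ⊕ b ⊗ by) ⊗ ay
          ≡⟨ solve 8 (λ a b ax ay bx by cx cy →
               (a :* cx :+ b :* cy) :* by :+ (a :* ax :+ b :* ay) :* cy :+ (a :* bx :+ b :* by) :* ay
               := a :* (ax :* cy :+ bx :* ay :+ cx :* by) :+ b :* (ay :* by :+ by :* cy :+ cy :* ay))
               refl a b ax ay bx by cx cy ⟩
        a ⊗ Rhs ⊕ b ⊗ (ay ⊗ by ⊕ by ⊗ cy ⊕ cy ⊗ ay) ∎)
      b-eq : b ⊗ Lhs ≡ b ⊗ Rhs
      b-eq = KP.+-cancelʳ (a ⊗ (ax ⊗ bx ⊕ bx ⊗ cx ⊕ cx ⊗ ax)) _ _ (begin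
        b ⊗ Lhs ⊕ a ⊗ (ax ⊗ bx ⊕ bx ⊗ cx ⊕ cx ⊗ ax)
          ≡⟨ solve 8 (λ a b ax ay bx by cx cy →
               b :* (ax :* by :+ bx :* cy :+ cx :* ay) :+ a :* (ax :* bx :+ bx :* cx :+ cx :* ax)
               := (a :* bx :+ b :* by) :* ax :+ (a :* cx :+ b :* cy) :* bx :+ (a :* ax :+ b :* ay) :* cx)
               refl a b ax ay bx by cx cy ⟩
        (a ⊗ bx ⊕ b ⊗ by) ⊗ ax ⊕ (a ⊗ cx ⊕ b ⊗ cy) ⊗ bx ⊕ (a ⊗ ax ⊕ b ⊗ ay) ⊗ cx
          ≡⟨ cong₂ _⊕_ (cong₂ _⊕_ (cong (_⊗ ax) (trans eb (sym ec))) (cong (_⊗ bx) (trans ec (sym ea)))) (cong (_⊗ cx) (trans ea (sym eb))) ⟩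
        (a ⊗ cx ⊕ b ⊗ cy) ⊗ ax ⊕ (a ⊗ ax ⊕ b ⊗ ay) ⊗ bx ⊕ (a ⊗ bx ⊕ b ⊗ by) ⊗ cx
          ≡⟨ solve 8 (λ a b ax ay bx by cx cy →
               (a :* cx :+ b :* cy) :* ax :+ (a :* ax :+ b :* ay) :* bx :+ (a :* bx :+ b :* by) :* cx
               := b :* (ax :* cy :+ bx :* ay :+ cx :* by) :+ a :* (ax :* bx :+ bx :* cx :+ cx :* ax))
               refl a b ax ay bx by cx cy ⟩
        b ⊗ Rhs ⊕ a ⊗ (ax ⊗ bx ⊕ bx ⊗ cx ⊕ cx ⊗ ax) ∎)

    module _ (p q : Carrier) (p+ay : p ⊕ ay ≡ by) (q+bx : q ⊕ bx ≡ ax) where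

      -- The vector `(p , q) = (by − ay , ax − bx)` is normal to the line through `a` and `b`.
      -- Describing it by sums reduces everything to semiring identities.
      area⇒onLine : Lhs ≡ Rhs → p ⊗ cx ⊕ q ⊗ cy ≡ p ⊗ ax ⊕ q ⊗ ay
      area⇒onLine eq = KP.+-cancelʳ (ay ⊗ cx ⊕ bx ⊗ cy ⊕ (ay ⊗ ax ⊕ bx ⊗ ay)) _ _ (begin
        p ⊗ cx ⊕ q ⊗ cy ⊕ (ay ⊗ cx ⊕ bx ⊗ cy ⊕ (ay ⊗ ax ⊕ bx ⊗ ay))
          ≡⟨ solve 7 (λ p q ax ay bx cx cy →
               p :* cx :+ q :* cy :+ (ay :* cx :+ bx :* cy :+ (ay :* ax :+ bx :* ay))
               := (p :+ ay) :* cx :+ (q :+ bx) :* cy :+ (ay :* ax :+ bx :* ay)) refl p q ax ay bx cx cy ⟩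
        (p ⊕ ay) ⊗ cx ⊕ (q ⊕ bx) ⊗ cy ⊕ (ay ⊗ ax ⊕ bx ⊗ ay)
          ≡⟨ cong₂ (λ u v → u ⊗ cx ⊕ v ⊗ cy ⊕ (ay ⊗ ax ⊕ bx ⊗ ay)) p+ay q+bx ⟩
        by ⊗ cx ⊕ ax ⊗ cy ⊕ (ay ⊗ ax ⊕ bx ⊗ ay)
          ≡⟨ solve 6 (λ ax ay bx by cx cy → by :* cx :+ ax :* cy :+ (ay :* ax :+ bx :* ay)
               := (ax :* cy :+ bx :* ay :+ cx :* by) :+ ay :* ax) refl ax ay bx by cx cy ⟩
        Rhs ⊕ ay ⊗ ax
          ≡⟨ cong (_⊕ ay ⊗ ax) eq ⟨
        Lhs ⊕ ay ⊗ ax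
          ≡⟨ solve 6 (λ ax ay bx by cx cy → (ax :* by :+ bx :* cy :+ cx :* ay) :+ ay :* ax
               := by :* ax :+ ax :* ay :+ (ay :* cx :+ bx :* cy)) refl ax ay bx by cx cy ⟩
        by ⊗ ax ⊕ ax ⊗ ay ⊕ (ay ⊗ cx ⊕ bx ⊗ cy)
          ≡⟨ cong₂ (λ u v → u ⊗ ax ⊕ v ⊗ ay ⊕ (ay ⊗ cx ⊕ bx ⊗ cy)) p+ay q+bx ⟨
        (p ⊕ ay) ⊗ ax ⊕ (q ⊕ bx) ⊗ ay ⊕ (ay ⊗ cx ⊕ bx ⊗ cy)
          ≡⟨ solve 7 (λ p q ax ay bx cx cy →
               (p :+ ay) :* ax :+ (q :+ bx) :* ay :+ (ay :* cx :+ bx :* cy)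
               := p :* ax :+ q :* ay :+ (ay :* cx :+ bx :* cy :+ (ay :* ax :+ bx :* ay))) refl p q ax ay bx cx cy ⟩
        p ⊗ ax ⊕ q ⊗ ay ⊕ (ay ⊗ cx ⊕ bx ⊗ cy ⊕ (ay ⊗ ax ⊕ bx ⊗ ay)) ∎)
        where open ≡-Reasoning

  embed : ℕ → ℕ → Point
  embed x y = ι x , ι y

  private
    ι-area : ∀ a b c d e f → ι (a * b + c * d + e * f) ≡ ι a ⊗ ι b ⊕ ι c ⊗ ι d ⊕ ι e ⊗ ι f
    ι-area a b c d e f = trans (ι-+ (a * b + c * d) (e * f))
      (cong₂ _⊕_ (trans (ι-+ (a * b) (c * d)) (cong₂ _⊕_ (ι-* a b) (ι-* c d))) (ι-* e f))

  onLine⇒collinear : ∀ ax ay bx by cx cy (L : Line) →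
    embed ax ay OnLine L → embed bx by OnLine L → embed cx cy OnLine L → CollinearTriple ax ay bx by cx cy
  onLine⇒collinear ax ay bx by cx cy L ea eb ec =
    decidable-stable (ax * by + bx * cy + cx * ay ≟ ax * cy + bx * ay + cx * by) λ ne →
      onLine⇒area (ι ax) (ι ay) (ι bx) (ι by) (ι cx) (ι cy) L ea eb ec λ eq →
        ne (ι-injective (trans (ι-area ax by bx cy cx ay) (trans eq (sym (ι-area ax cy bx ay cx by)))))

  collinear⇒onLine : ∀ ax ay bx by cx cy → ax ≢ bx → CollinearTriple ax ay bx by cx cy →
    Σ Line λ L → embed ax ay OnLine L × embed bx by OnLine L × embed cx cy OnLine L
  collinear⇒onLine ax ay bx by cx cy ax≢bx col =
    line p q (p ⊗ ι ax ⊕ q ⊗ ι ay) (λ (_ , q≡0) → ax≢bx (ι-injective (begin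
      ι ax         ≡⟨ q+bx ⟨
      q ⊕ ι bx     ≡⟨ cong (_⊕ ι bx) q≡0 ⟩
      0# ⊕ ι bx    ≡⟨ K.+-identityˡ (ι bx) ⟩
      ι bx ∎))) , refl ,
    area⇒onLine (ι ax) (ι ay) (ι bx) (ι by) (ι bx) (ι by) p q p+ay q+bx
      (solve 4 (λ ax ay bx by → ax :* by :+ bx :* by :+ bx :* ay := ax :* by :+ bx :* ay :+ bx :* by)
        refl (ι ax) (ι ay) (ι bx) (ι by)) ,
    area⇒onLine (ι ax) (ι ay) (ι bx) (ι by) (ι cx) (ι cy) p q p+ay q+bx
      (trans (sym (ι-area ax by bx cy cx ay)) (trans (cong ι col) (ι-area ax cy bx ay cx by)))
    where
    open ≡-Reasoning
    p q : Carrier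
    p = ι by ⊕ ⊖ ι ay
    q = ι ax ⊕ ⊖ ι bx
    restore : ∀ u v → u ⊕ ⊖ v ⊕ v ≡ u
    restore u v = trans (K.+-assoc u (⊖ v) v) (trans (cong (u ⊕_) (K.-‿inverseˡ v)) (K.+-identityʳ u))
    p+ay : p ⊕ ι ay ≡ ι by
    p+ay = restore (ι by) (ι ay)
    q+bx : q ⊕ ι bx ≡ ι ax
    q+bx = restore (ι ax) (ι bx)

-- Blocks of copies and the iterated logarithm

∈-++ˡ : ∀ {m n} {S : Subset m} (T : Subset n) {x} → x ∈ S → (x ↑ˡ n) ∈ (S ++ T)
∈-++ˡ T here      = here
∈-++ˡ T (there p) = there (∈-++ˡ T p)

∈-++ʳ : ∀ {m n} (S : Subset m) {T : Subset n} {x} → x ∈ T → (m ↑ʳ x) ∈ (S ++ T)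
∈-++ʳ []      p = p
∈-++ʳ (_ ∷ S) p = there (∈-++ʳ S p)

∣++∣ : ∀ {m n} (S : Subset m) (T : Subset n) → ∣ S ++ T ∣ ≡ ∣ S ∣ + ∣ T ∣
∣++∣ []          T = refl
∣++∣ (true ∷ S)  T = cong suc (∣++∣ S T)
∣++∣ (false ∷ S) T = ∣++∣ S T

blockwise-bound : ∀ k n g T (S : Subset (T * g)) →
  (∀ (t : Fin T) (U : Subset g) → (∀ {p} → p ∈ U → combine t p ∈ S) → k * ∣ U ∣ ≤ n) → k * ∣ S ∣ ≤ T * n
blockwise-bound k n g zero    [] small = ≤-reflexive (*-zeroʳ k)
blockwise-bound k n g (suc T) S  small with splitAt g S
... | U , S′ , refl = begin
  k * ∣ U ++ S′ ∣          ≡⟨ cong (k *_) (∣++∣ U S′) ⟩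
  k * (∣ U ∣ + ∣ S′ ∣)     ≡⟨ *-distribˡ-+ k ∣ U ∣ ∣ S′ ∣ ⟩
  k * ∣ U ∣ + k * ∣ S′ ∣
    ≤⟨ +-mono-≤ (small zero U (∈-++ˡ S′)) (blockwise-bound k n g T S′ λ t W W⊆ → small (suc t) W (∈-++ʳ U ∘ W⊆)) ⟩
  n + T * n ∎
  where open ≤-Reasoning

-- Regards an index set of the first `N` points as one of all complete copies, so that
-- `blockwise-bound` applies.
pad : ∀ {N N′} (le : N ≤ N′) (S : Subset N) →
      ∃ λ (S′ : Subset N′) → ∣ S′ ∣ ≡ ∣ S ∣ × (∀ {x} → x ∈ S′ → ∃ λ a → a ∈ S × inject≤ a le ≡ x)
pad {N′ = N′} _ [] = ⊥ , ∣⊥∣≡0 N′ , λ x∈⊥ → contradiction x∈⊥ ∉⊥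
pad {N′ = suc _} (s≤s le) (true ∷ S) with pad le S
... | S′ , eq , back = true ∷ S′ , cong suc eq , λ
  { here → zero , here , refl ; (there x∈) → let a , a∈ , e = back x∈ in suc a , there a∈ , cong suc e }
pad {N′ = suc _} (s≤s le) (false ∷ S) with pad le S
... | S′ , eq , back = false ∷ S′ , eq , λ
  { (there x∈) → let a , a∈ , e = back x∈ in suc a , there a∈ , cong suc e }

module Construction (ℝ : RealField) {m D k n : ℕ} (cfg : Configuration (Grid.grid m D) k n)
  (N : ℕ) .{{_ : NonZero n}} (n≤N : n ≤ N) where
  open Plane ℝ
  open RealPlane ℝ
  open Configuration cfg using (size; size≤; size≥; small)

  instance
    size≢0 : NonZero size
    size≢0 = ≢-nonZero λ eq → <⇒≱ (>-nonZero⁻¹ n) (subst (λ s → n ≤ 2 * s) eq size≥)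

  T : ℕ
  -- One copy beyond the quotient covers the remainder; its cost is absorbed because `size ≤ n ≤ N`.
  T = suc (N / size)

  N≤T*size : N ≤ T * size
  N≤T*size = begin
    N                            ≡⟨ m≡m%n+[m/n]*n N size ⟩
    N % size + N / size * size   ≤⟨ +-monoˡ-≤ (N / size * size) (<⇒≤ (m%n<n N size)) ⟩
    T * size ∎
    where open ≤-Reasoning

  T*n≤4N : T * n ≤ 4 * N
  T*n≤4N = begin
    T * n                              ≤⟨ *-monoʳ-≤ T size≥ ⟩
    T * (2 * size)                     ≡⟨ rearrange (N / size) size ⟩
    2 * (size + N / size * size)       ≤⟨ *-monoʳ-≤ 2 (+-mono-≤ (≤-trans size≤ n≤N) (m/n*n≤m N size)) ⟩
    2 * (N + N)                        ≡⟨ double N ⟩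
    4 * N ∎
    where
    open ≤-Reasoning
    rearrange : ∀ a s → suc a * (2 * s) ≡ 2 * (s + a * s)
    rearrange = solve-∀
    double : ∀ a → 2 * (a + a) ≡ 4 * a
    double = solve-∀

  open Copies cfg T

  at : Fin N → Fin (T * size)
  at a = inject≤ a N≤T*size

  at-injective : ∀ {a b} → at a ≡ at b → a ≡ b
  at-injective = inject≤-injective N≤T*size N≤T*size _ _

  points : Fin N → Point
  points a = embed (X (at a)) (Y (at a))

  points-injective : Injective _≡_ _≡_ points
  points-injective eq = at-injective (X-distinct (ι-injective (cong proj₁ eq)))

  onLine⇒aligned : ∀ L a b c → points a OnLine L → points b OnLine L → points c OnLine L → Aligned (at a) (at b) (at c)
  onLine⇒aligned L a b c = onLine⇒collinear (X (at a)) (Y (at a)) (X (at b)) (Y (at b)) (X (at c)) (Y (at c)) L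

  atMostThree : AtMostThreeOnALine points
  atMostThree a b c e ab ac ae bc be ce (L , oa , ob , oc , oe) =
    noFourAligned (at a) (at b) (at c) (at e) (ab ∘ at-injective) (ac ∘ at-injective) (ae ∘ at-injective)
      (bc ∘ at-injective) (be ∘ at-injective) (ce ∘ at-injective)
      (onLine⇒aligned L a b c oa ob oc , onLine⇒aligned L a b e oa ob oe , onLine⇒aligned L a c e oa oc oe)

  -- An axis-collinear triple within a copy would be collinear in the plane. Hence the part of `S`
  -- in each copy is unaligned, and `small` applies to each of the `T` copies.
  generalPosition-small : ∀ S → GeneralPosition points S → k * ∣ S ∣ ≤ 4 * N
  generalPosition-small S gp with pad N≤T*size S
  ... | S′ , eq , back = ≤-trans (subst (λ s → k * s ≤ T * n) eq (blockwise-bound k n size T S′ block)) T*n≤4N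
    where
    block : ∀ t (U : Subset size) → (∀ {p} → p ∈ U → combine t p ∈ S′) → k * ∣ U ∣ ≤ n
    block t U U⊆ = small U λ i p q s p∈ q∈ s∈ pq ps qs (pars , qars) →
      let a , a∈ , ea = back (U⊆ p∈)
          b , b∈ , eb = back (U⊆ q∈)
          c , c∈ , ec = back (U⊆ s∈)
          distinct : ∀ {x y p q} → at x ≡ combine t p → at y ≡ combine t q → p ≢ q → x ≢ y
          distinct ex ey p≢q x≡y = p≢q (combine-injectiveʳ t _ t _ (trans (sym ex) (trans (cong at x≡y) ey)))
          split : ∀ {x p} → at x ≡ combine t p → remQuot {T} size (at x) ≡ (t , p)
          split {p = p} ex = trans (cong (remQuot size) ex) (remQuot-combine t p)
          copy≡ : ∀ {x y p q} → at x ≡ combine t p → at y ≡ combine t q → copyOf (at x) ≡ copyOf (at y)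
          copy≡ ex ey = trans (cong proj₁ (split ex)) (sym (cong proj₁ (split ey)))
          in≡ : ∀ {x p} → at x ≡ combine t p → p ≡ inCopy (at x)
          in≡ ex = sym (cong proj₂ (split ex))
      in gp a b c a∈ b∈ c∈ (distinct ea eb pq) (distinct ea ec ps) (distinct eb ec qs)
           (collinear⇒onLine (X (at a)) (Y (at a)) (X (at b)) (Y (at b)) (X (at c)) (Y (at c))
             (λ Xeq → distinct ea eb pq (at-injective (X-distinct Xeq)))
             (parallel⇒aligned (at a) (at b) (at c) i (copy≡ ea ec) (copy≡ eb ec) (distinct ea eb pq ∘ at-injective)
               (subst₂ (λ p s → Par p i s) (in≡ ea) (in≡ ec) pars)
               (subst₂ (λ q s → Par q i s) (in≡ eb) (in≡ ec) qars)))
      where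
      open Configuration cfg using (point)
      Par : Fin size → Fin D → Fin size → Set
      Par p i s = Grid.Parallel m (point p) i (point s)

2^⌊log₂⌋≤ : ∀ x → 1 ≤ x → 2 ^ ⌊log₂ x ⌋ ≤ x
2^⌊log₂⌋≤ = <-rec (λ x → 1 ≤ x → 2 ^ ⌊log₂ x ⌋ ≤ x) step
  where
  open ≤-Reasoning
  step : ∀ x → (∀ {y} → y < x → 1 ≤ y → 2 ^ ⌊log₂ y ⌋ ≤ y) → 1 ≤ x → 2 ^ ⌊log₂ x ⌋ ≤ x
  step 1 rec _ = ≤-refl
  step x@(suc (suc x′)) rec _ = begin
    2 ^ ⌊log₂ x ⌋               ≤⟨ ^-monoʳ-≤ 2 (m≤n+m∸n ⌊log₂ x ⌋ 1) ⟩
    2 * 2 ^ (⌊log₂ x ⌋ ∸ 1)     ≡⟨ cong (λ l → 2 * 2 ^ l) (⌊log₂⌊n/2⌋⌋≡⌊log₂n⌋∸1 x) ⟨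
    2 * 2 ^ ⌊log₂ ⌊ x /2⌋ ⌋     ≤⟨ *-monoʳ-≤ 2 (rec (⌊n/2⌋<n (suc x′)) (s≤s z≤n)) ⟩
    2 * ⌊ x /2⌋                 ≡⟨ cong (_+_ ⌊ x /2⌋) (+-identityʳ _) ⟩
    ⌊ x /2⌋ + ⌊ x /2⌋           ≤⟨ +-monoʳ-≤ ⌊ x /2⌋ (⌊n/2⌋≤⌈n/2⌉ x) ⟩
    ⌊ x /2⌋ + ⌈ x /2⌉           ≡⟨ ⌊n/2⌋+⌈n/2⌉≡n x ⟩
    x ∎

logStarFuel≤ : ∀ f x → logStarFuel f x ≤ x
logStarFuel≤ zero    x             = z≤n
logStarFuel≤ (suc f) zero          = z≤n
logStarFuel≤ (suc f) (suc zero)    = z≤n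
logStarFuel≤ (suc f) (suc (suc x)) = ≤-trans (s≤s (logStarFuel≤ f ⌊log₂ suc (suc x) ⌋))
  (<-≤-trans (n<2^n _) (2^⌊log₂⌋≤ (suc (suc x)) (s≤s z≤n)))

-- The remaining fuel is existential, since `logStarFuel≤` later bounds the value for every amount
-- of fuel.
logStarFuel-step : ∀ f x → ∃ λ f′ → logStarFuel f x ≤ suc (logStarFuel f′ ⌊log₂ x ⌋)
logStarFuel-step zero    x             = 0 , z≤n
logStarFuel-step (suc f) zero          = f , z≤n
logStarFuel-step (suc f) (suc zero)    = f , z≤n
logStarFuel-step (suc f) (suc (suc x)) = f , ≤-refl

log*≤3+log³ : ∀ x → log* x ≤ 3 + ⌊log₂ ⌊log₂ ⌊log₂ x ⌋ ⌋ ⌋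
log*≤3+log³ x =
  let f₁ , le₁ = logStarFuel-step x x
      f₂ , le₂ = logStarFuel-step f₁ ⌊log₂ x ⌋
      f₃ , le₃ = logStarFuel-step f₂ ⌊log₂ ⌊log₂ x ⌋ ⌋
  in ≤-trans le₁ (s≤s (≤-trans le₂ (s≤s (≤-trans le₃ (s≤s (logStarFuel≤ f₃ _))))))

-- The start 13 is the least positive exponent that works: 5200 is below 8192, but 4800 exceeds
-- 4096.
400*k≤2^k : ∀ j → 400 * (13 + j) ≤ 2 ^ (13 + j)
400*k≤2^k zero    = m≤m+n 5200 2992
400*k≤2^k (suc j) = begin
  400 * (13 + suc j)               ≡⟨ expand j ⟩
  400 + 400 * (13 + j)             ≤⟨ +-mono-≤ (≤-trans (m≤m*n 400 (13 + j)) (400*k≤2^k j)) (400*k≤2^k j) ⟩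
  2 ^ (13 + j) + 2 ^ (13 + j)      ≡⟨ cong (_+_ (2 ^ (13 + j))) (+-identityʳ _) ⟨
  2 ^ suc (13 + j)                 ≡⟨ cong (2 ^_) (+-suc 13 j) ⟨
  2 ^ (13 + suc j) ∎
  where
  open ≤-Reasoning
  expand : ∀ j → 400 * (13 + suc j) ≡ 400 + 400 * (13 + j)
  expand = solve-∀

log³-large : ∀ h N → 2 ^ 2 ^ 2 ^ h ≤ N → h ≤ ⌊log₂ ⌊log₂ ⌊log₂ N ⌋ ⌋ ⌋
log³-large h N le = peel h (⌊log₂ ⌊log₂ N ⌋ ⌋) (peel (2 ^ h) ⌊log₂ N ⌋ (peel (2 ^ 2 ^ h) N le))
  where
  peel : ∀ a b → 2 ^ a ≤ b → a ≤ ⌊log₂ b ⌋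
  peel a b le = subst (_≤ ⌊log₂ b ⌋) (⌊log₂[2^n]⌋≡n a) (⌊log₂⌋-mono-≤ le)

abstract
  log³-unbounded : ∀ h → ∃ λ N₀ → ∀ N → N₀ ≤ N → h ≤ ⌊log₂ ⌊log₂ ⌊log₂ N ⌋ ⌋ ⌋
  log³-unbounded h = 2 ^ 2 ^ 2 ^ h , log³-large h

-- Undoing the three rounded logarithms one after another gives `2 ^ 2 ^ 2 ^ k ≤ N`, and
-- `400 * k ≤ 2 ^ k` from 13 on. Hence the configuration is small enough to be copied within `N`
-- points.
log-suffices : ∀ N k → 13 ≤ k → k ≡ ⌊log₂ ⌊log₂ ⌊log₂ N ⌋ ⌋ ⌋ → 2 ^ 2 ^ (400 * k) ≤ N
log-suffices N k 13≤k eq = begin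
  2 ^ 2 ^ (400 * k)       ≤⟨ ^-monoʳ-≤ 2 (^-monoʳ-≤ 2 (subst (λ k → 400 * k ≤ 2 ^ k) (m+[n∸m]≡n 13≤k) (400*k≤2^k (k ∸ 13)))) ⟩
  2 ^ 2 ^ 2 ^ k           ≤⟨ ^-monoʳ-≤ 2 (^-monoʳ-≤ 2 (≤-trans (≤-reflexive (cong (2 ^_) eq)) (2^⌊log₂⌋≤ l₂ 1≤l₂))) ⟩
  2 ^ 2 ^ l₂              ≤⟨ ^-monoʳ-≤ 2 (2^⌊log₂⌋≤ l₁ 1≤l₁) ⟩
  2 ^ l₁                  ≤⟨ 2^⌊log₂⌋≤ N 1≤N ⟩
  N ∎
  where
  open ≤-Reasoning
  l₁ = ⌊log₂ N ⌋
  l₂ = ⌊log₂ l₁ ⌋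
  log-positive : ∀ x → 1 ≤ ⌊log₂ x ⌋ → 1 ≤ x
  log-positive zero ()
  log-positive (suc x) _ = s≤s z≤n
  1≤l₂ : 1 ≤ l₂
  1≤l₂ = log-positive l₂ (subst (1 ≤_) eq (≤-trans (m≤m+n 1 12) 13≤k))
  1≤l₁ : 1 ≤ l₁
  1≤l₁ = log-positive l₁ 1≤l₂
  1≤N : 1 ≤ N
  1≤N = log-positive N 1≤l₁

-- The hypothesis `k * s ≤ 4 * N` is stronger than the square-root bound, so the crude estimate
-- `l ≤ 2 * k ≤ 2 * (k * k)` suffices, and 32 arises as 2 times the square of 4.
square-bound : ∀ k s N l → 13 ≤ k → l ≤ 3 + k → k * s ≤ 4 * N → s ^ 2 * l ≤ 32 * N ^ 2
square-bound k s N l 13≤k l≤ ks≤ = begin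
  s ^ 2 * l             ≤⟨ *-monoʳ-≤ (s ^ 2) (begin
    l                     ≤⟨ l≤ ⟩
    3 + k                 ≤⟨ +-monoˡ-≤ k (≤-trans (m≤m+n 3 10) 13≤k) ⟩
    k + k                 ≡⟨ cong (_+_ k) (+-identityʳ k) ⟨
    2 * k                 ≤⟨ *-monoʳ-≤ 2 (m≤m*n k k {{>-nonZero (≤-trans (m≤m+n 1 12) 13≤k)}}) ⟩
    2 * (k * k) ∎) ⟩
  s ^ 2 * (2 * (k * k)) ≡⟨ regroup s k ⟩
  2 * (k * s) ^ 2       ≤⟨ *-monoʳ-≤ 2 (^-monoˡ-≤ 2 ks≤) ⟩
  2 * (4 * N) ^ 2       ≡⟨ expand N ⟩
  32 * N ^ 2 ∎
  where
  open ≤-Reasoning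
  regroup : ∀ s k → s * (s * 1) * (2 * (k * k)) ≡ 2 * ((k * s) * ((k * s) * 1))
  regroup = solve-∀
  expand : ∀ N → 2 * ((4 * N) * ((4 * N) * 1)) ≡ 32 * (N * (N * 1))
  expand = solve-∀

theorem3 : (ℝ : RealField) → let open Plane ℝ in
    Σ ℕ λ C → Σ ℕ λ N → ∀ (n : ℕ) → N ≤ n →
    Σ (Fin n → Point) λ P → Injective _≡_ _≡_ P × AtMostThreeOnALine P ×
    (∀ (S : Subset n) → GeneralPosition P S → ∣ S ∣ ^ 2 * log* n ≤ C * n ^ 2)
-- The threshold makes the triple logarithm `k` at least 13, where `log-suffices` and `square-bound`
-- apply.
theorem3 ℝ = 32 , N₀ , λ n N₀≤n →
  let k = ⌊log₂ ⌊log₂ ⌊log₂ n ⌋ ⌋ ⌋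
      13≤k = large n N₀≤n
      m , D , size , 1≤size , cfg , size≤ = gridConfiguration k (≤-trans (m≤m+n 1 12) 13≤k)
      open Construction ℝ cfg n {{>-nonZero 1≤size}} (≤-trans size≤ (log-suffices n k 13≤k refl))
  in points , points-injective , atMostThree ,
     λ S gp → square-bound k ∣ S ∣ n (log* n) 13≤k (log*≤3+log³ n) (generalPosition-small S gp)
  where
  N₀ = proj₁ (log³-unbounded 13)
  large = proj₂ (log³-unbounded 13)
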